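{- Let $p$ be a prime, $N=p^e$ with $e\ge1$, let $h\ge1$ be a divisor of $N-1$, put $A=(N-1)/h$ and $\Lambda_{N,h}(U)=U(U^A-1)^h\in\mathbb F_p[U]$. Let $Q=p^m$ with $m\ge1$ and put $s=p^{\gcd(e,m)}$, $C=(N-1)/(s-1)$, $\kappa=\gcd(h,C)$. Assume $Q\ge N$. Then $\Lambda_{N,h}$ is not a permutation polynomial of $\mathbb F_Q$, and its exact defect from the Wan--Shiue--Chen upper bound for non-permutation polynomials of degree $N$ is $$\left(Q-\left\lceil\frac{Q-1}{N}\right\rceil\right)-\#\Lambda_{N,h}(\mathbb F_Q)=\frac{\kappa(s-1)Q}{hs}-\left\lceil\frac{Q-1}{N}\right\rceil.$$ If $\mathbb F_N\subseteq\mathbb F_Q$, then this simplifies to $$\left(Q-\left\lceil\frac{Q-1}{N}\right\rceil\right)-\#\Lambda_{N,h}(\mathbb F_Q)=\frac{Q(N-1-h)}{Nh}.$$ Thus, when $\mathbb F_N\subseteq\mathbb F_Q$, equality $\#\Lambda_{N,h}(\mathbb F_Q)=Q-\lceil (Q-1)/N\rceil$ with the Wan--Shiue--Chen bound holds if and only if $h=N-1$.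
   Context: All finite fields of characteristic $p$ are regarded as subfields of a fixed algebraic closure $\overline{\mathbb F}_p$, so $\mathbb F_N\subseteq\mathbb F_Q$ means $e\mid m$. A polynomial $f\in\mathbb F_Q[U]$ is a permutation polynomial of $\mathbb F_Q$ if it induces a bijection $\mathbb F_Q\to\mathbb F_Q$. $\Lambda_{N,h}(\mathbb F_Q)$ denotes the image of $\Lambda_{N,h}$ on $\mathbb F_Q$. The Wan--Shiue--Chen upper bound is the known inequality $\#f(\mathbb F_Q)\le Q-\lceil (Q-1)/d\rceil$ for a polynomial $f\in\mathbb F_Q[U]$ of degree $d$ that is not a permutation polynomial of $\mathbb F_Q$. -}

module Defs where

open import Level using (Level; _⊔_; suc)
open import Algebra.Apartness.Bundles using (HeytingField; HeytingCommutativeRing)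
open import Algebra.Bundles using (CommutativeRing)
open import Data.Fin.Base using (Fin)
import Data.Fin.Properties as Fin
open import Data.Integer.Base as ℤ using (ℤ; +_)
open import Data.List.Base as List using (List; []; _∷_; allFin; deduplicate; length)
open import Data.Nat.Base as ℕ using (ℕ; NonZero; _∸_; nonTrivial⇒n>1; >-nonZero; ≢-nonZero; ≢-nonZero⁻¹)
open import Data.Nat.DivMod using (_/_)
open import Data.Nat.GCD using (gcd; gcd[m,n]≡0⇒m≡0)
import Data.Nat.Properties as ℕ
open import Data.Nat.Primality using (Prime; prime⇒nonZero; prime⇒nonTrivial)
import Data.Rational.Base as ℚ
open import Function.Base using (_∘_)
open import Function.Bundles using (Inverse)
open import Function.Definitions using (Bijective)
open import Function.Properties.Inverse using (Inverse⇒Injection)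
open import Relation.Binary.Definitions using (Decidable)
import Relation.Binary.PropositionalEquality as ≡
open import Relation.Nullary.Decidable using (via-injection)

-- Coefficient lists, constant term first; trailing zeros are allowed, so
-- a polynomial has several representatives, all with the same evaluation.
module Polynomials {c ℓ : Level} (R : CommutativeRing c ℓ) where
  open CommutativeRing R

  infixl 6 _+ₚ_ _-ₚ_
  infixl 7 _*ₚ_
  infixr 8 _^ₚ_

  Poly : Set c
  Poly = List Carrier

  1ₚ : Poly
  1ₚ = 1# ∷ []

  U : Poly
  U = 0# ∷ 1# ∷ []

  _+ₚ_ : Poly → Poly → Poly
  []      +ₚ g       = g
  (a ∷ f) +ₚ []      = a ∷ f
  (a ∷ f) +ₚ (b ∷ g) = (a + b) ∷ (f +ₚ g)

  _-ₚ_ : Poly → Poly → Poly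
  f -ₚ g = f +ₚ List.map (-_) g

  _*ₚ_ : Poly → Poly → Poly
  []      *ₚ g = []
  (a ∷ f) *ₚ g = List.map (a *_) g +ₚ (0# ∷ (f *ₚ g))

  _^ₚ_ : Poly → ℕ → Poly
  f ^ₚ ℕ.zero  = 1ₚ
  f ^ₚ ℕ.suc n = f *ₚ (f ^ₚ n)

  eval : Poly → Carrier → Carrier
  eval []      x = 0#
  eval (a ∷ f) x = a + x * eval f x

  -- The quotient (N ∸ 1) / h is only meant for h ∣ N ∸ 1.
  Λ : (N h : ℕ) .{{_ : NonZero h}} → Poly
  Λ N h = U *ₚ (U ^ₚ A -ₚ 1ₚ) ^ₚ h
    where
    A : ℕ
    A = (N ∸ 1) / h

-- A field with exactly Q elements.  The enumeration makes equality decidable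
-- and inverses searchable, so the apartness _#_ of the underlying Heyting
-- field is necessarily logically equivalent to ¬ (x ≈ y).
record FiniteField (c ℓ₁ ℓ₂ : Level) (Q : ℕ) : Set (suc (c ⊔ ℓ₁ ⊔ ℓ₂)) where
  field
    heytingField : HeytingField c ℓ₁ ℓ₂

  commutativeRing : CommutativeRing c ℓ₁
  commutativeRing =
    HeytingCommutativeRing.commutativeRing
      (HeytingField.heytingCommutativeRing heytingField)

  open CommutativeRing commutativeRing public using (Carrier; _≈_; setoid)

  field
    enumeration : Inverse setoid (≡.setoid (Fin Q))

  _≟_ : Decidable _≈_
  _≟_ = via-injection (Inverse⇒Injection enumeration) Fin._≟_

  elements : List Carrier
  elements = List.map (Inverse.from enumeration) (allFin Q)

  open Polynomials commutativeRing public

  IsPermutationPolynomial : Poly → Set (c ⊔ ℓ₁)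
  IsPermutationPolynomial f = Bijective _≈_ _≈_ (eval f)

  -- The number of distinct values of f.
  #image : Poly → ℕ
  #image f = length (deduplicate _≟_ (List.map (eval f) elements))

-- Q - ⌈(Q - 1) / d⌉, computed in ℤ.
wanShiueChenBound : (Q d : ℕ) .{{_ : NonZero d}} → ℤ
wanShiueChenBound Q d = + Q ℤ.- ℚ.ceiling (+ (Q ∸ 1) ℚ./ d)

p^k≢0 : ∀ {p} → Prime p → ∀ k → NonZero (p ℕ.^ k)
p^k≢0 {p} pr k = ℕ.m^n≢0 p k {{prime⇒nonZero pr}}

p^k∸1≢0 : ∀ {p} → Prime p → ∀ k .{{_ : NonZero k}} → NonZero (p ℕ.^ k ∸ 1)
p^k∸1≢0 {p} pr k@(ℕ.suc _) =
  >-nonZero (ℕ.m<n⇒0<n∸m (ℕ.^-monoʳ-< p 1<p {0} {k} (ℕ.s≤s ℕ.z≤n)))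
  where
  1<p : 1 ℕ.< p
  1<p = nonTrivial⇒n>1 p {{prime⇒nonTrivial pr}}

gcd≢0 : ∀ m n .{{_ : NonZero m}} → NonZero (gcd m n)
gcd≢0 m n = ≢-nonZero (≢-nonZero⁻¹ m ∘ gcd[m,n]≡0⇒m≡0)

{-# OPTIONS --safe #-}

-- Write N = 1 + hA, L w = w^N - w and V = L(F_Q).  Frobenius makes L additive with kernel F_s, so
-- |V| = Q / s.  The values missed by Λ are exactly the a for which a^A = x^(N-1) for some x ∉ V:
--   * if u (u^A - 1)^h = a and a^A = x^(N-1), then y = x / (u^A - 1)
--     satisfies y^(N-1) = u^A, whence x = L y ∈ V;
--   * a solution w of a^A w^N - w = 1 gives Λ(a w^h) = a (a^A w^N - w)^h = a.  The left side is additive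
--     in w, so a solution exists unless a^A w^N = w for some w ≠ 0; then a^A = x^(N-1) for x = 1/w, and
--     if x = L y, then w y is a solution.
-- Counting the pairs (a, x) in both ways, the number μ of missed values satisfies
-- μ (s - 1) = (Q - Q/s) gcd(A, s - 1), and h gcd(A, s - 1) = κ (s - 1).

module Submission where

open import Defs
open import Level using (Level; _⊔_)
open import Algebra.Apartness.Bundles using (HeytingField)
open import Algebra.Bundles using (CommutativeMonoid; CommutativeRing)
import Algebra.Properties.CommutativeMonoid.Sum as CommutativeMonoidSum
import Algebra.Properties.CommutativeSemiring.Binomial as BinomialTheorem
import Algebra.Properties.CommutativeSemiring.Exp as Exp
import Algebra.Properties.Ring as RingProperties
import Algebra.Properties.Semiring.Mult as Mult
import Algebra.Solver.Ring.NaturalCoefficients.Default as SemiringSolver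
open import Data.Bool.Base using (if_then_else_)
open import Data.Fin.Base as Fin using (Fin)
import Data.Fin.Properties as Fin
open import Data.Integer.Base as ℤ using (ℤ; +_)
import Data.Integer.DivMod as ℤ
import Data.Integer.Properties as ℤ
import Data.Integer.Tactic.RingSolver as ℤ-Solver
open import Data.List.Base as List using (List; []; _∷_; deduplicate; length)
import Data.List.Membership.DecSetoid as DecMembership
open import Data.List.Membership.Propositional.Properties using (∈-allFin)
import Data.List.Membership.Setoid.Properties as Membership
import Data.List.Relation.Unary.All as All
open import Data.List.Relation.Unary.AllPairs.Core using ([]; _∷_)
open import Data.List.Relation.Unary.Any using (here; there)
import Data.List.Relation.Unary.Unique.DecSetoid as DecUnique
import Data.List.Relation.Unary.Unique.DecSetoid.Properties as Unique
open import Data.Nat.Base as ℕ using (ℕ; NonZero; zero; suc; _∸_; _≤_; _<_; z≤n; s≤s; _!)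
open import Data.Nat.Combinatorics using (_C_; nCn≡1; nCk≡n!/k![n-k]!; k![n∸k]!∣n!)
open import Data.Nat.DivMod using (_/_; m/n*n≡m; m*[n/m]≡n)
open import Data.Nat.Divisibility using (_∣_; divides; ∣⇒≤; ∣-refl; ∣-antisym; ∣-trans; m∣m*n)
open import Data.Nat.GCD
  using (gcd; module Bézout; c*gcd[m,n]≡gcd[cm,cn]; gcd-GCD; gcd-comm; gcd-greatest; gcd[m,n]∣m; gcd[m,n]∣n)
open import Data.Nat.Primality using (Prime; euclidsLemma; prime⇒nonTrivial)
import Data.Nat.Properties as ℕ
import Data.Nat.Tactic.RingSolver as ℕ-Solver
open import Data.Product.Base using (_×_; _,_; proj₁; proj₂; ∃; ∃-syntax)
open import Data.Rational.Base as ℚ using (ceiling; floor; ↥_; ↧_)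
import Data.Rational.Properties as ℚ
open import Data.Rational.Unnormalised.Base as ℚᵘ using (mkℚᵘ; *≡*)
import Data.Rational.Unnormalised.Properties as ℚᵘ
open import Data.Sum.Base using (_⊎_; inj₁; inj₂; [_,_]′)
open import Data.Unit.Base using (tt)
open import Function.Base using (_∘_)
open import Function.Bundles using (Inverse; _⇔_; mk⇔)
import Function.Construct.Composition as Composition
import Function.Construct.Symmetry as Symmetry
open import Function.Properties.Inverse using (Inverse⇒Injection)
open import Relation.Binary.Bundles using (Setoid; DecSetoid)
open import Relation.Binary.Core using (Rel; _Preserves_⟶_)
open import Relation.Binary.Definitions using (_Respects_) renaming (Decidable to Decidable₂)
open import Relation.Binary.PropositionalEquality as ≡ using (_≡_)
open import Relation.Nullary.Decidable
  using (Dec; yes; no; does; map′; ¬?; _×-dec_; decidable-stable; via-injection)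
open import Relation.Nullary.Negation using (¬_; contradiction)
open import Relation.Unary using (Pred; Decidable)

-- Counting in finite setoids

-- The substitution u = a w^h is chosen because hA = N - 1: it turns u (u^A - 1)^h = a, for a ≠ 0,
-- into (a^A w^N - w)^h = 1, and it is enough to make the additive expression inside equal to 1.
-- Solvability then depends only on the kernel of an additive map of a finite group. The number s
-- enters through F_N ∩ F_Q: w^N = w and w^Q = w together force w^s = w, by Bézout for the exponents
-- e and m. In the double count, an x belonging to a may be replaced exactly by ζ x with ζ^(N-1) =
-- 1, which gives s - 1 choices. Conversely x^(N-1) = (x^h)^A, so the a belonging to x are x^h times
-- the A-th roots of unity, gcd(A, s - 1) in number.

⟦_⟧ : ∀ {a} {P : Set a} → Dec P → ℕ
⟦ P? ⟧ = if does P? then 1 else 0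

⟦⟧-yes : ∀ {a} {P : Set a} (P? : Dec P) → P → ⟦ P? ⟧ ≡ 1
⟦⟧-yes (yes _) p = ≡.refl
⟦⟧-yes (no ¬p) p = contradiction p ¬p

⟦⟧-no : ∀ {a} {P : Set a} (P? : Dec P) → ¬ P → ⟦ P? ⟧ ≡ 0
⟦⟧-no (yes p) ¬p = contradiction p ¬p
⟦⟧-no (no _)  ¬p = ≡.refl

⟦⟧-mono : ∀ {a b} {P : Set a} {Q : Set b} (P? : Dec P) (Q? : Dec Q) → (P → Q) → ⟦ P? ⟧ ≤ ⟦ Q? ⟧
⟦⟧-mono (yes p) Q? f = ℕ.≤-reflexive (≡.sym (⟦⟧-yes Q? (f p)))
⟦⟧-mono (no _)  Q? f = z≤n

⟦⟧-⊎ : ∀ {a b r} {P : Set a} {Q : Set b} {R : Set r} (P? : Dec P) (Q? : Dec Q) (R? : Dec R) →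
        ¬ (P × Q) → (P → R) → (Q → R) → (R → P ⊎ Q) → ⟦ P? ⟧ ℕ.+ ⟦ Q? ⟧ ≡ ⟦ R? ⟧
⟦⟧-⊎ (yes p) (yes q) R?      dis f g h = contradiction (p , q) dis
⟦⟧-⊎ (yes p) (no ¬q) R?      dis f g h = ≡.sym (⟦⟧-yes R? (f p))
⟦⟧-⊎ (no ¬p) (yes q) R?      dis f g h = ≡.sym (⟦⟧-yes R? (g q))
⟦⟧-⊎ (no ¬p) (no ¬q) R?      dis f g h = ≡.sym (⟦⟧-no R? ([ ¬p , ¬q ]′ ∘ h))

⟦⟧-∪ : ∀ {a b r} {P : Set a} {Q : Set b} {R : Set r} (P? : Dec P) (Q? : Dec Q) (R? : Dec R) →
        (R → P ⊎ Q) → ⟦ R? ⟧ ≤ ⟦ P? ⟧ ℕ.+ ⟦ Q? ⟧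
⟦⟧-∪ P?      Q?      (no _)  f = z≤n
⟦⟧-∪ (yes _) Q?      (yes _) f = s≤s z≤n
⟦⟧-∪ (no _)  (yes _) (yes _) f = s≤s z≤n
⟦⟧-∪ (no ¬p) (no ¬q) (yes r) f = contradiction (f r) [ ¬p , ¬q ]′

open CommutativeMonoidSum ℕ.+-0-commutativeMonoid
  using (sum; sum-cong-≗; ∑-distrib-+; ∑-comm; sum-replicate-zero)

sum-mono : ∀ {n} {f g : Fin n → ℕ} → (∀ i → f i ≤ g i) → sum f ≤ sum g
sum-mono {zero}  f≤g = z≤n
sum-mono {suc n} f≤g = ℕ.+-mono-≤ (f≤g Fin.zero) (sum-mono (f≤g ∘ Fin.suc))

sum-*ʳ : ∀ {n} (f : Fin n → ℕ) k → sum (λ i → f i ℕ.* k) ≡ sum f ℕ.* k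
sum-*ʳ {zero}  f k = ≡.refl
sum-*ʳ {suc n} f k = ≡.trans (≡.cong (f Fin.zero ℕ.* k ℕ.+_) (sum-*ʳ (f ∘ Fin.suc) k))
                             (≡.sym (ℕ.*-distribʳ-+ k (f Fin.zero) _))

sum-1 : ∀ n → sum {n} (λ _ → 1) ≡ n
sum-1 zero    = ≡.refl
sum-1 (suc n) = ≡.cong suc (sum-1 n)

sum-≟ : ∀ {n} (j : Fin n) → sum (λ i → ⟦ i Fin.≟ j ⟧) ≡ 1
sum-≟ {suc n} Fin.zero    = ≡.cong suc (sum-replicate-zero n)
sum-≟ {suc n} (Fin.suc j) = sum-≟ j

module FiniteSetoid {c ℓ} (S : Setoid c ℓ) {n : ℕ} (enumeration : Inverse S (≡.setoid (Fin n))) where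
  open Setoid S renaming (Carrier to X)
  open Inverse enumeration using (to; from; to-cong; strictlyInverseˡ; strictlyInverseʳ)

  infix 4 _≟_
  _≟_ : Decidable₂ _≈_
  _≟_ = via-injection (Inverse⇒Injection enumeration) Fin._≟_

  decSetoid : DecSetoid c ℓ
  decSetoid = record { isDecEquivalence = record { isEquivalence = isEquivalence ; _≟_ = _≟_ } }

  from-injective : ∀ {i j} → from i ≈ from j → i ≡ j
  from-injective {i} {j} eq =
    ≡.trans (≡.sym (strictlyInverseˡ i)) (≡.trans (to-cong eq) (strictlyInverseˡ j))

  ∃? : ∀ {a} {P : Pred X a} → Decidable P → P Respects _≈_ → Dec (∃ P)
  ∃? P? resp = map′ (λ (i , p) → from i , p)
                    (λ (x , p) → to x , resp (sym (strictlyInverseʳ x)) p)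
                    (Fin.any? (P? ∘ from))

  module _ {c′ ℓ′} (M : CommutativeMonoid c′ ℓ′) where
    open CommutativeMonoid M using () renaming (Carrier to C; _≈_ to _≈ᴹ_)
    open CommutativeMonoidSum M using () renaming (sum to ∑; sum-permute to ∑-permute; sum-cong-≋ to ∑-cong)

    -- Conjugating φ by the enumeration permutes the indices. The monoid is arbitrary because the
    -- same fact serves counts in ℕ, the product of the units and the sum of all field elements.
    sum-reindex : (t : X → C) → t Preserves _≈_ ⟶ _≈ᴹ_ → (φ : Inverse S S) →
                  ∑ (t ∘ from) ≈ᴹ ∑ (t ∘ Inverse.to φ ∘ from)
    sum-reindex t t-cong φ = CommutativeMonoid.trans M
      (∑-permute (t ∘ from)
        (Composition.inverse (Composition.inverse (Symmetry.inverse enumeration) φ) enumeration))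
      (∑-cong (λ i → t-cong (strictlyInverseʳ (Inverse.to φ (from i)))))

  -- A sum of indicators rather than the length of a list, so that permuting indices and exchanging
  -- double sums apply directly.
  # : ∀ {a} {P : Pred X a} → Decidable P → ℕ
  # P? = sum (λ i → ⟦ P? (from i) ⟧)

  module _ {a b} {P : Pred X a} {Q : Pred X b} (P? : Decidable P) (Q? : Decidable Q) where

    #-mono : (∀ x → P x → Q x) → # P? ≤ # Q?
    #-mono P⊆Q = sum-mono (λ i → ⟦⟧-mono (P? _) (Q? _) (P⊆Q (from i)))

    #-⊎ : ∀ {r} {R : Pred X r} (R? : Decidable R) → (∀ {x} → ¬ (P x × Q x)) →
          (∀ {x} → P x → R x) → (∀ {x} → Q x → R x) → (∀ {x} → R x → P x ⊎ Q x) →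
          # P? ℕ.+ # Q? ≡ # R?
    #-⊎ R? disjoint P⊆R Q⊆R R⊆P∪Q = ≡.trans (≡.sym (∑-distrib-+ (λ i → ⟦ P? (from i) ⟧) (λ i → ⟦ Q? (from i) ⟧)))
      (sum-cong-≗ (λ i → ⟦⟧-⊎ (P? (from i)) (Q? (from i)) (R? (from i)) disjoint P⊆R Q⊆R R⊆P∪Q))

    #-∪ : ∀ {r} {R : Pred X r} (R? : Decidable R) → (∀ {x} → R x → P x ⊎ Q x) → # R? ≤ # P? ℕ.+ # Q?
    #-∪ R? R⊆P∪Q = ℕ.≤-trans
      (sum-mono λ i → ⟦⟧-∪ (P? (from i)) (Q? (from i)) (R? (from i)) R⊆P∪Q)
      (ℕ.≤-reflexive (∑-distrib-+ (λ i → ⟦ P? (from i) ⟧) (λ i → ⟦ Q? (from i) ⟧)))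

    #-partition : (∀ {x} → P x → ¬ Q x) → (∀ {x} → ¬ Q x → P x) → # P? ℕ.+ # Q? ≡ n
    #-partition P⇒¬Q ¬Q⇒P =
      ≡.trans (#-⊎ (λ _ → yes tt) (λ (p , q) → P⇒¬Q p q) _ _ λ {x} _ → P-or-Q x) (sum-1 n)
      where
      P-or-Q : ∀ x → P x ⊎ Q x
      P-or-Q x with Q? x
      ... | yes q = inj₂ q
      ... | no ¬q = inj₁ (¬Q⇒P ¬q)

  #-cong : ∀ {a b} {P : Pred X a} {Q : Pred X b} (P? : Decidable P) (Q? : Decidable Q) →
           (∀ x → P x → Q x) → (∀ x → Q x → P x) → # P? ≡ # Q?
  #-cong P? Q? P⊆Q Q⊆P = ℕ.≤-antisym (#-mono P? Q? P⊆Q) (#-mono Q? P? Q⊆P)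

  #-empty : ∀ {a} {P : Pred X a} (P? : Decidable P) → (∀ x → ¬ P x) → # P? ≡ 0
  #-empty P? ¬P = ≡.trans (sum-cong-≗ (λ i → ⟦⟧-no (P? (from i)) (¬P (from i)))) (sum-replicate-zero n)

  #-≟ : ∀ r → # (_≟ r) ≡ 1
  #-≟ r = ≡.trans (sum-cong-≗ (λ i → ℕ.≤-antisym
      (⟦⟧-mono (from i ≟ r) (i Fin.≟ to r) (λ eq → ≡.trans (≡.sym (strictlyInverseˡ i)) (to-cong eq)))
      (⟦⟧-mono (i Fin.≟ to r) (from i ≟ r) λ {≡.refl → strictlyInverseʳ r})))
    (sum-≟ (to r))

  #-unique : ∀ {a} {P : Pred X a} (P? : Decidable P) → P Respects _≈_ →
             ∀ r → P r → (∀ {x} → P x → x ≈ r) → # P? ≡ 1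
  #-unique P? resp r Pr unique =
    ≡.trans (#-cong P? (_≟ r) (λ _ → unique) (λ _ eq → resp (sym eq) Pr)) (#-≟ r)

  #≡0⇒empty : ∀ {a} {P : Pred X a} (P? : Decidable P) → P Respects _≈_ → # P? ≡ 0 → ∀ x → ¬ P x
  #≡0⇒empty P? resp #P≡0 x Px = contradiction
    (ℕ.≤-trans (ℕ.≤-reflexive (≡.sym (#-≟ x)))
      (ℕ.≤-trans (#-mono (_≟ x) P? (λ _ eq → resp (sym eq) Px)) (ℕ.≤-reflexive #P≡0)))
    (λ ())

  -- Pigeonhole: a full count leaves count 0 for the complement. This later turns injectivity of an
  -- additive map into surjectivity.
  #-full : ∀ {a} {P : Pred X a} (P? : Decidable P) → P Respects _≈_ → # P? ≡ n → ∀ x → P x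
  #-full {P = P} P? resp #P≡n x with P? x
  ... | yes Px = Px
  ... | no ¬Px = contradiction ¬Px (#≡0⇒empty (¬? ∘ P?) (λ eq ¬p p → ¬p (resp (sym eq) p)) #¬P≡0 x)
    where
    #¬P≡0 : # (¬? ∘ P?) ≡ 0
    #¬P≡0 = ℕ.+-cancelˡ-≡ (# P?) _ 0 (≡.trans
      (#-partition P? (¬? ∘ P?) (λ p ¬p → ¬p p) (λ {y} → decidable-stable (P? y)))
      (≡.trans (≡.sym #P≡n) (≡.sym (ℕ.+-identityʳ _))))

  #-reindex : ∀ {a} {P : Pred X a} (P? : Decidable P) → P Respects _≈_ → (φ : Inverse S S) →
              # P? ≡ # (λ x → P? (Inverse.to φ x))
  #-reindex P? resp = sum-reindex ℕ.+-0-commutativeMonoid (⟦_⟧ ∘ P?)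
    (λ eq → ℕ.≤-antisym (⟦⟧-mono (P? _) (P? _) (resp eq)) (⟦⟧-mono (P? _) (P? _) (resp (sym eq))))

  -- Both sides count the pairs in R. Rows outside P and columns outside Q are empty because R
  -- entails both predicates.
  double-count : ∀ {r p q} {R : Rel X r} {P : Pred X p} {Q : Pred X q}
                 (R? : Decidable₂ R) (P? : Decidable P) (Q? : Decidable Q) {k l} →
                 (∀ {x y} → R x y → P x) → (∀ {x y} → R x y → Q y) →
                 (∀ {x} → P x → # (λ y → R? x y) ≡ k) → (∀ {y} → Q y → # (λ x → R? x y) ≡ l) →
                 # P? ℕ.* k ≡ # Q? ℕ.* l
  double-count R? P? Q? {k} {l} R⇒P R⇒Q row column = begin
    # P? ℕ.* k                                       ≡⟨ sum-*ʳ (λ i → ⟦ P? (from i) ⟧) k ⟨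
    sum (λ i → ⟦ P? (from i) ⟧ ℕ.* k)
      ≡⟨ sum-cong-≗ (fibre (λ {x} → P? x) R? R⇒P row ∘ from) ⟨
    sum (λ i → sum λ j → ⟦ R? (from i) (from j) ⟧) ≡⟨ ∑-comm (λ i j → ⟦ R? (from i) (from j) ⟧) ⟩
    sum (λ j → sum λ i → ⟦ R? (from i) (from j) ⟧)
      ≡⟨ sum-cong-≗ (fibre (λ {x} → Q? x) (λ y x → R? x y) R⇒Q column ∘ from) ⟩
    sum (λ j → ⟦ Q? (from j) ⟧ ℕ.* l)                ≡⟨ sum-*ʳ (λ j → ⟦ Q? (from j) ⟧) l ⟩
    # Q? ℕ.* l                                       ∎
    where
    open ≡.≡-Reasoning
    fibre : ∀ {r p} {R : Rel X r} {P : Pred X p} (P? : ∀ {x} → Dec (P x)) (R? : Decidable₂ R) {k} →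
            (∀ {x y} → R x y → P x) → (∀ {x} → P x → # (R? x) ≡ k) →
            ∀ x → # (R? x) ≡ ⟦ P? {x} ⟧ ℕ.* k
    fibre P? R? R⇒P row x with P? {x}
    ... | yes p = ≡.trans (row p) (≡.sym (ℕ.+-identityʳ _))
    ... | no ¬p = #-empty (R? x) (λ y r → ¬p (R⇒P r))

  open DecMembership decSetoid using (_∈_; _∈?_)
  open DecUnique decSetoid using (Unique)

  length-unique : ∀ {xs} → Unique xs → length xs ≡ # (_∈? xs)
  length-unique {[]}     []         = ≡.sym (#-empty (_∈? []) (λ _ ()))
  length-unique {x ∷ xs} (x∉ ∷ xs!) = ≡.trans
    (≡.cong₂ ℕ._+_ (≡.sym (#-≟ x)) (length-unique xs!))
    (#-⊎ (_≟ x) (_∈? xs) (_∈? (x ∷ xs))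
      (λ { (y≈x , y∈xs) → All.lookupₛ S (λ eq x≉ x≈ → x≉ (trans x≈ (sym eq))) x∉ y∈xs (sym y≈x) })
      here there λ { (here y≈x) → inj₁ y≈x ; (there y∈xs) → inj₂ y∈xs })

  length-deduplicate : ∀ xs → length (deduplicate _≟_ xs) ≡ # (_∈? xs)
  length-deduplicate xs = ≡.trans (length-unique (Unique.deduplicate-! decSetoid xs))
    (#-cong (_∈? deduplicate _≟_ xs) (_∈? xs)
      (λ _ → Membership.∈-deduplicate⁻ S _≟_ xs)
      (λ _ → Membership.∈-deduplicate⁺ S _≟_ (λ eq y≈z → trans y≈z (sym eq))))

  image? : {f : X → X} → f Preserves _≈_ ⟶ _≈_ → ∀ y → Dec (∃[ x ] f x ≈ y)
  image? {f} f-cong y = ∃? (λ x → f x ≟ y) (λ x≈z → trans (f-cong (sym x≈z)))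

  -- Links the list-based definition of `#image` to the indicator counts used everywhere else.
  #-image : ∀ {f} (f-cong : f Preserves _≈_ ⟶ _≈_) →
            length (deduplicate _≟_ (List.map f (List.map from (List.allFin n)))) ≡ # (image? f-cong)
  #-image {f} f-cong = ≡.trans (length-deduplicate values)
    (#-cong (_∈? values) (image? f-cong)
      (λ y y∈ → let x , _ , y≈fx = Membership.∈-map⁻ S S y∈ in x , sym y≈fx)
      (λ y (x , fx≈y) → Membership.∈-resp-≈ S (trans (f-cong (strictlyInverseʳ x)) fx≈y)
        (Membership.∈-map⁺ S S f-cong
          (Membership.∈-map⁺ (≡.setoid (Fin n)) S (reflexive ∘ ≡.cong from) (∈-allFin (to x))))))
    where
    values : List X
    values = List.map f (List.map from (List.allFin n))

-- Divisibility

prime∤! : ∀ {p} → Prime p → ∀ {k} → k < p → ¬ p ∣ k !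
prime∤! pr {zero}  k<p p∣1 =
  contradiction (∣⇒≤ p∣1) (ℕ.<⇒≱ (ℕ.nonTrivial⇒n>1 _ {{prime⇒nonTrivial pr}}))
prime∤! pr {suc k} k<p p∣k! = [ (λ p∣1+k → contradiction (∣⇒≤ p∣1+k) (ℕ.<⇒≱ k<p))
                              , prime∤! pr (ℕ.<-trans (ℕ.n<1+n k) k<p) ]′
                              (euclidsLemma (suc k) (k !) pr p∣k!)

-- The prime p divides p! = (p C k) k! (p - k)!, but neither of the two factorials, as both k and p
-- - k are below p.
prime∣binomial : ∀ {p} → Prime p → ∀ {k} → 0 < k → k < p → p ∣ (p C k)
prime∣binomial {p@(suc p-1)} pr {k@(suc k-1)} 0<k k<p =
  [ (λ p∣C → p∣C)
  , (λ p∣d → contradiction (euclidsLemma (k !) ((p ∸ k) !) pr p∣d)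
      [ prime∤! pr k<p , prime∤! pr (s≤s (ℕ.m∸n≤m p-1 k-1)) ]′) ]′
  (euclidsLemma (p C k) (k ! ℕ.* (p ∸ k) !) pr (≡.subst (p ∣_) p!≡ (m∣m*n (p-1 !))))
  where
  k≤p = ℕ.<⇒≤ k<p
  instance _ = k ℕ.!* (p ∸ k) !≢0
  p!≡ : p ! ≡ (p C k) ℕ.* (k ! ℕ.* (p ∸ k) !)
  p!≡ = ≡.trans (≡.sym (m/n*n≡m (k![n∸k]!∣n! k≤p)))
                (≡.cong (ℕ._* (k ! ℕ.* (p ∸ k) !)) (≡.sym (nCk≡n!/k![n-k]! k≤p)))

-- Induction through s^(k+1) - 1 = s (s^k - 1) + (s - 1), so a quotient q becomes s q + 1.
geometric-∣ : ∀ s k .{{_ : NonZero s}} → s ∸ 1 ∣ s ℕ.^ k ∸ 1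
geometric-∣ (suc y) zero    = divides 0 ≡.refl
geometric-∣ (suc y) (suc k) with geometric-∣ (suc y) k
... | divides q eq = divides (suc y ℕ.* q ℕ.+ 1)
  (≡.trans (≡.cong (λ z → suc y ℕ.* z ∸ 1) s^k≡) (expand y q))
  where
  s^k≡ : suc y ℕ.^ k ≡ suc (q ℕ.* y)
  s^k≡ = ≡.trans (≡.sym (ℕ.m+[n∸m]≡n (ℕ.m^n>0 (suc y) k))) (≡.cong suc eq)
  expand : ∀ y q → q ℕ.* y ℕ.+ y ℕ.* suc (q ℕ.* y) ≡ (suc y ℕ.* q ℕ.+ 1) ℕ.* y
  expand = ℕ-Solver.solve-∀

suc-pred≡ : ∀ n .{{_ : NonZero n}} → n ≡ suc (n ∸ 1)
suc-pred≡ (suc n) = ≡.refl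

1<p^k : ∀ {p} → Prime p → ∀ k .{{_ : NonZero k}} → 1 < p ℕ.^ k
1<p^k {p} p-prime (suc k) =
  ℕ.^-monoʳ-< p (ℕ.nonTrivial⇒n>1 p {{prime⇒nonTrivial p-prime}}) {0} {suc k} (s≤s z≤n)

-- Finite fields

module FiniteFieldProperties {c ℓ₁ ℓ₂} {Q} (1<Q : 1 < Q) (F : FiniteField c ℓ₁ ℓ₂ Q) where
  open FiniteField F using (heytingField; commutativeRing; enumeration)
  open CommutativeRing commutativeRing
  open FiniteSetoid setoid enumeration
  open Inverse enumeration using (from)
  open Exp commutativeSemiring
  open Mult semiring using (×1-homo-*; ×-congʳ; ×-congˡ; ×-comm-*) renaming (_×_ to _·_)
  open RingProperties ring
  open SemiringSolver commutativeSemiring using (solve; _:=_; _:+_; _:*_)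
  open import Relation.Binary.Reasoning.Setoid setoid

  -- If 1 = 0, all elements coincide, whereas 1 < Q provides two different indices.
  1≉0 : ¬ 1# ≈ 0#
  1≉0 1≈0 = contradiction (≡.cong Fin.toℕ 0≡1) λ 0≡1 →
    ℕ.0≢1+n (≡.trans (≡.sym (Fin.toℕ-fromℕ< 0<Q)) (≡.trans 0≡1 (Fin.toℕ-fromℕ< 1<Q)))
    where
    0<Q = ℕ.<-trans (s≤s z≤n) 1<Q
    all≈0 : ∀ x → x ≈ 0#
    all≈0 x = trans (sym (*-identityˡ x)) (trans (*-congʳ 1≈0) (zeroˡ x))
    0≡1 : Fin.fromℕ< 0<Q ≡ Fin.fromℕ< 1<Q
    0≡1 = from-injective (trans (all≈0 _) (sym (all≈0 _)))

  -- Apartness is only ¬¬-implied by inequality, but the inverse can be found by search.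
  inverse : ∀ {x} → ¬ x ≈ 0# → ∃ λ y → y * x ≈ 1#
  inverse {x} x≉0 with ∃? (λ y → y * x ≟ 1#) (λ y≈z → trans (*-congʳ (sym y≈z)))
  ... | yes y = y
  ... | no ∄y = contradiction (proj₁ (tight x 0#) λ x#0 →
                  let y , y*[x-0]≈1 , _ = #⇒invertible x#0
                  in ∄y (y , trans (*-congˡ (sym (trans (+-congˡ -0#≈0#) (+-identityʳ x)))) y*[x-0]≈1))
                x≉0
    where open HeytingField heytingField using (tight; #⇒invertible)

  inverse-cancels : ∀ {x y} → y * x ≈ 1# → ∀ z → y * (x * z) ≈ z
  inverse-cancels yx≈1 z = trans (sym (*-assoc _ _ z)) (trans (*-congʳ yx≈1) (*-identityˡ z))

  *-cancelˡ : ∀ {x} → ¬ x ≈ 0# → ∀ {y z} → x * y ≈ x * z → y ≈ z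
  *-cancelˡ x≉0 {y} {z} xy≈xz with inverse x≉0
  ... | x⁻¹ , x⁻¹x≈1 = trans (sym (inverse-cancels x⁻¹x≈1 y)) (trans (*-congˡ xy≈xz) (inverse-cancels x⁻¹x≈1 z))

  *-≉0 : ∀ {x y} → ¬ x ≈ 0# → ¬ y ≈ 0# → ¬ x * y ≈ 0#
  *-≉0 x≉0 y≉0 xy≈0 = y≉0 (*-cancelˡ x≉0 (trans xy≈0 (sym (zeroʳ _))))

  ^-≉0 : ∀ {x} → ¬ x ≈ 0# → ∀ n → ¬ x ^ n ≈ 0#
  ^-≉0 x≉0 zero    = 1≉0
  ^-≉0 x≉0 (suc n) = *-≉0 x≉0 (^-≉0 x≉0 n)

  1^n≈1 : ∀ n → 1# ^ n ≈ 1#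
  1^n≈1 zero    = refl
  1^n≈1 (suc n) = trans (*-identityˡ _) (1^n≈1 n)

  0^n≈0 : ∀ n .{{_ : NonZero n}} → 0# ^ n ≈ 0#
  0^n≈0 (suc n) = zeroˡ _

  ^≈1⇒≉0 : ∀ {x} n .{{_ : NonZero n}} → x ^ n ≈ 1# → ¬ x ≈ 0#
  ^≈1⇒≉0 n x^n≈1 x≈0 = 1≉0 (trans (sym x^n≈1) (trans (^-congˡ n x≈0) (0^n≈0 n)))

  scaling : ∀ {x} → ¬ x ≈ 0# → Inverse setoid setoid
  scaling {x} x≉0 = let y , yx≈1 = inverse x≉0 in record
    { to        = x *_
    ; from      = y *_
    ; to-cong   = *-congˡ
    ; from-cong = *-congˡ
    ; inverse   = (λ {z} eq → trans (*-congˡ eq) (inverse-cancels (trans (*-comm x y) yx≈1) z))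
                , (λ {z} eq → trans (*-congˡ eq) (inverse-cancels yx≈1 z))
    }

  translation : Carrier → Inverse setoid setoid
  translation x = record
    { to        = _+ x
    ; from      = _- x
    ; to-cong   = +-congʳ
    ; from-cong = +-congʳ
    ; inverse   = (λ {z} eq → trans (+-congʳ eq) (//-rightDividesˡ x z))
                , (λ {z} eq → trans (+-congʳ eq) (//-rightDividesʳ x z))
    }

  nonzero? : ∀ x → Dec (¬ x ≈ 0#)
  nonzero? x = ¬? (x ≟ 0#)

  #nonzero : # nonzero? ≡ Q ∸ 1
  #nonzero = ≡.cong (_∸ 1) (≡.trans (≡.cong (ℕ._+ # nonzero?) (≡.sym (#-≟ 0#)))
    (#-partition (_≟ 0#) nonzero? (λ x≈0 x≉0 → x≉0 x≈0) (λ {x} → decidable-stable (x ≟ 0#))))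

  -- Multiplication by x permutes the nonzero elements, hence fixes their product.
  fermat : ∀ {x} → ¬ x ≈ 0# → x ^ (Q ∸ 1) ≈ 1#
  fermat {x} x≉0 = trans (^-congʳ x (≡.sym #nonzero)) (*-cancelˡ (∏≉0 (unit ∘ from) (unit≉0 ∘ from)) (begin
    ∏units * x ^ # nonzero?                                          ≈⟨ *-comm _ _ ⟩
    x ^ # nonzero? * ∏units
      ≈⟨ *-congʳ (∏^ (λ i → ⟦ nonzero? (from i) ⟧)) ⟨
    ∏ (λ i → x ^ ⟦ nonzero? (from i) ⟧) * ∏units
      ≈⟨ ∏-distrib-* (λ i → x ^ ⟦ nonzero? (from i) ⟧) (unit ∘ from) ⟨
    ∏ (λ i → x ^ ⟦ nonzero? (from i) ⟧ * unit (from i)) ≈⟨ ∏-cong (unit-scaled ∘ from) ⟨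
    ∏ (λ i → unit (x * from i))
      ≈⟨ sum-reindex *-commutativeMonoid unit unit-cong (scaling x≉0) ⟨
    ∏units                                                           ≈⟨ *-identityʳ _ ⟨
    ∏units * 1#                                                      ∎))
    where
    open CommutativeMonoidSum *-commutativeMonoid using ()
      renaming (sum to ∏; sum-cong-≋ to ∏-cong; ∑-distrib-+ to ∏-distrib-*)

    -- Zero is replaced by 1, so that the product of the units can run over the whole enumeration
    -- and still be cancelled.
    unit : Carrier → Carrier
    unit y with y ≟ 0#
    ... | yes _ = 1#
    ... | no _  = y

    ∏units : Carrier
    ∏units = ∏ (unit ∘ from)

    unit-cong : unit Preserves _≈_ ⟶ _≈_
    unit-cong {y} {z} y≈z with y ≟ 0# | z ≟ 0#
    ... | yes _   | yes _   = refl
    ... | yes y≈0 | no z≉0  = contradiction (trans (sym y≈z) y≈0) z≉0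
    ... | no y≉0  | yes z≈0 = contradiction (trans y≈z z≈0) y≉0
    ... | no _    | no _    = y≈z

    unit≉0 : ∀ y → ¬ unit y ≈ 0#
    unit≉0 y with y ≟ 0#
    ... | yes _  = 1≉0
    ... | no y≉0 = y≉0

    unit-scaled : ∀ y → unit (x * y) ≈ x ^ ⟦ nonzero? y ⟧ * unit y
    unit-scaled y with y ≟ 0# | x * y ≟ 0#
    ... | yes y≈0 | yes _    =
      sym (trans (*-congʳ (^-congʳ x (⟦⟧-no (nonzero? y) (λ y≉0 → y≉0 y≈0)))) (*-identityˡ _))
    ... | yes y≈0 | no xy≉0  = contradiction (trans (*-congˡ y≈0) (zeroʳ x)) xy≉0
    ... | no y≉0  | yes xy≈0 = contradiction xy≈0 (*-≉0 x≉0 y≉0)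
    ... | no y≉0  | no _     = *-congʳ (sym (trans (^-congʳ x (⟦⟧-yes (nonzero? y) y≉0)) (*-identityʳ x)))

    ∏≉0 : ∀ {n} (f : Fin n → Carrier) → (∀ i → ¬ f i ≈ 0#) → ¬ ∏ f ≈ 0#
    ∏≉0 {zero}  f f≉0 = 1≉0
    ∏≉0 {suc n} f f≉0 = *-≉0 (f≉0 Fin.zero) (∏≉0 (f ∘ Fin.suc) (f≉0 ∘ Fin.suc))

    ∏^ : ∀ {n} (f : Fin n → ℕ) → ∏ (λ i → x ^ f i) ≈ x ^ sum f
    ∏^ {zero}  f = refl
    ∏^ {suc n} f = trans (*-congˡ (∏^ (f ∘ Fin.suc))) (sym (^-homo-* x (f Fin.zero) _))

  -- Monic polynomial functions in Horner form. The index is the degree, so no degree or leading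
  -- coefficient has to be extracted from coefficient lists.
  data Monic : ℕ → (Carrier → Carrier) → Set (c ⊔ ℓ₁) where
    one    : ∀ {f} → (∀ x → f x ≈ 1#) → Monic 0 f
    horner : ∀ {n f g} c → (∀ x → f x ≈ x * g x + c) → Monic n g → Monic (suc n) f

  monic-cong : ∀ {n f} → Monic n f → f Preserves _≈_ ⟶ _≈_
  monic-cong (one f≈)        x≈y = trans (f≈ _) (sym (f≈ _))
  monic-cong (horner c f≈ g) x≈y = trans (f≈ _) (trans (+-congʳ (*-cong x≈y (monic-cong g x≈y))) (sym (f≈ _)))

  -- f x - f r = (x - r) q x, with both sides moved so that no subtraction occurs.
  divide : ∀ {n f} → Monic (suc n) f → ∀ r →
           ∃ λ q → Monic n q × (∀ x → f x + r * q x ≈ f r + x * q x)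
  divide {f = f} (horner {g = g} c f≈ (one g≈)) r = (λ _ → 1#) , one (λ _ → refl) , λ x → begin
    f x + r * 1#         ≈⟨ +-congʳ (trans (f≈ x) (+-congʳ (*-congˡ (g≈ x)))) ⟩
    x * 1# + c + r * 1#  ≈⟨ solve 3 (λ x c r → x :+ c :+ r := r :+ c :+ x) refl (x * 1#) c (r * 1#) ⟩
    r * 1# + c + x * 1#  ≈⟨ +-congʳ (trans (f≈ r) (+-congʳ (*-congˡ (g≈ r)))) ⟨
    f r + x * 1#         ∎
  divide {f = f} (horner {g = g} c f≈ g-monic@(horner _ _ _)) r with divide g-monic r
  -- Synthetic division: if q is the quotient of g by x - r, then x q(x) + g(r) is the quotient of x
  -- g(x) + c.
  ... | q , q-monic , g≈ = (λ x → x * q x + g r) , horner (g r) (λ _ → refl) q-monic , λ x → begin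
    f x + r * (x * q x + g r)          ≈⟨ +-congʳ (f≈ x) ⟩
    x * g x + c + r * (x * q x + g r)  ≈⟨ solve 6 (λ x r c gx gr qx → x :* gx :+ c :+ r :* (x :* qx :+ gr)
                                              := x :* (gx :+ r :* qx) :+ (r :* gr :+ c))
                                            refl x r c (g x) (g r) (q x) ⟩
    x * (g x + r * q x) + (r * g r + c) ≈⟨ +-congʳ (*-congˡ (g≈ x)) ⟩
    x * (g r + x * q x) + (r * g r + c)
      ≈⟨ solve 4 (λ x z c gr → x :* (gr :+ x :* z) :+ c := c :+ x :* (x :* z :+ gr))
                                            refl x (q x) (r * g r + c) (g r) ⟩
    r * g r + c + x * (x * q x + g r)  ≈⟨ +-congʳ (f≈ r) ⟨
    f r + x * (x * q x + g r)          ∎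

  -- Induction on the degree: a root r found by search splits off, and by `divide` every root other
  -- than r is a root of the quotient.
  #roots≤degree : ∀ {n f} → Monic n f → # (λ x → f x ≟ 0#) ≤ n
  #roots≤degree {f = f} (one f≈) =
    ℕ.≤-reflexive (#-empty (λ x → f x ≟ 0#) (λ x fx≈0 → 1≉0 (trans (sym (f≈ x)) fx≈0)))
  #roots≤degree {suc n} {f} f-monic@(horner _ _ _)
    with ∃? (λ x → f x ≟ 0#) (λ x≈y → trans (monic-cong f-monic (sym x≈y)))
  ... | no ∄root = ℕ.≤-trans (ℕ.≤-reflexive (#-empty (λ x → f x ≟ 0#) (λ x fx≈0 → ∄root (x , fx≈0)))) z≤n
  ... | yes (r , fr≈0) with divide f-monic r
  ...   | q , q-monic , f≈ = ℕ.≤-trans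
    (#-∪ (_≟ r) (λ x → q x ≟ 0#) (λ x → f x ≟ 0#) root-split)
    (ℕ.+-mono-≤ (ℕ.≤-reflexive (#-≟ r)) (#roots≤degree q-monic))
    where
    root-split : ∀ {x} → f x ≈ 0# → x ≈ r ⊎ q x ≈ 0#
    root-split {x} fx≈0 with q x ≟ 0#
    ... | yes qx≈0 = inj₂ qx≈0
    ... | no qx≉0  = inj₁ (*-cancelˡ qx≉0 (begin
      q x * x       ≈⟨ *-comm _ _ ⟩
      x * q x       ≈⟨ +-identityˡ _ ⟨
      0# + x * q x  ≈⟨ +-congʳ fr≈0 ⟨
      f r + x * q x ≈⟨ f≈ x ⟨
      f x + r * q x ≈⟨ +-congʳ fx≈0 ⟩
      0# + r * q x  ≈⟨ +-identityˡ _ ⟩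
      r * q x       ≈⟨ *-comm _ _ ⟩
      q x * r       ∎))

  ^-monic : ∀ n → Monic n (_^ n)
  ^-monic zero    = one (λ _ → refl)
  ^-monic (suc n) = horner 0# (λ _ → sym (+-identityʳ _)) (^-monic n)

  -- Roots of unity

  root-of-unity? : ∀ n x → Dec (x ^ n ≈ 1#)
  root-of-unity? n x = x ^ n ≟ 1#

  #roots-of-unity≤ : ∀ n .{{_ : NonZero n}} → # (root-of-unity? n) ≤ n
  #roots-of-unity≤ (suc n) = ℕ.≤-trans
    (#-mono (root-of-unity? (suc n)) (λ x → x * x ^ n - 1# ≟ 0#) (λ _ → x≈y⇒x∙y⁻¹≈ε))
    (#roots≤degree (horner (- 1#) (λ _ → refl) (^-monic n)))

  -- Multiplication by x carries the n-th roots of unity bijectively onto the fibre through x.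
  #power-fibre : ∀ {x} n → ¬ x ≈ 0# → # (λ y → y ^ n ≟ x ^ n) ≡ # (root-of-unity? n)
  #power-fibre {x} n x≉0 = ≡.trans
    (#-reindex (λ y → y ^ n ≟ x ^ n) (λ eq → trans (^-congˡ n (sym eq))) (scaling x≉0))
    (#-cong (λ y → (x * y) ^ n ≟ x ^ n) (root-of-unity? n)
      (λ y eq → *-cancelˡ (^-≉0 x≉0 n) (trans (sym (^-distrib-* x y n)) (trans eq (sym (*-identityʳ _)))))
      (λ y eq → trans (^-distrib-* x y n) (trans (*-congˡ eq) (*-identityʳ _))))

  -- The n-th power map sends the Q - 1 units to the at most k roots of y^k = 1, with fibres
  -- of size at most n, where n k = Q - 1; so both bounds are attained.
  #roots-of-unity : ∀ n .{{_ : NonZero n}} → n ∣ Q ∸ 1 → # (root-of-unity? n) ≡ n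
  #roots-of-unity n (divides k Q-1≡kn) = ℕ.≤-antisym (#roots-of-unity≤ n)
    (ℕ.*-cancelˡ-≤ k (≡.subst (_≤ k ℕ.* # (root-of-unity? n)) (≡.trans #powers*#roots≡Q-1 Q-1≡kn)
      (ℕ.*-monoˡ-≤ (# (root-of-unity? n)) #powers≤k)))
    where
    instance
      k≢0 : NonZero k
      k≢0 = ℕ.≢-nonZero λ { ≡.refl → ℕ.<⇒≢ (ℕ.m<n⇒0<n∸m 1<Q) (≡.sym Q-1≡kn) }

    power? : ∀ y → Dec (∃[ x ] (¬ x ≈ 0#) × x ^ n ≈ y)
    power? y = ∃? (λ x → nonzero? x ×-dec (x ^ n ≟ y))
      (λ x≈z (x≉0 , x^n≈y) → (λ z≈0 → x≉0 (trans x≈z z≈0)) , trans (^-congˡ n (sym x≈z)) x^n≈y)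

    #powers≤k : # power? ≤ k
    #powers≤k = ℕ.≤-trans
      (#-mono power? (root-of-unity? k) λ y (x , x≉0 , x^n≈y) → begin
        y ^ k         ≈⟨ ^-congˡ k x^n≈y ⟨
        (x ^ n) ^ k   ≈⟨ ^-assocʳ x n k ⟩
        x ^ (n ℕ.* k) ≈⟨ ^-congʳ x (≡.trans (ℕ.*-comm n k) (≡.sym Q-1≡kn)) ⟩
        x ^ (Q ∸ 1)   ≈⟨ fermat x≉0 ⟩
        1#            ∎)
      (#roots-of-unity≤ k)

    #powers*#roots≡Q-1 : # power? ℕ.* # (root-of-unity? n) ≡ Q ∸ 1
    #powers*#roots≡Q-1 = ≡.trans
      (double-count (λ y x → nonzero? x ×-dec (x ^ n ≟ y)) power? nonzero? {# (root-of-unity? n)} {1}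
        (λ {y} {x} p → x , p) proj₁
        (λ { {y} (x , x≉0 , x^n≈y) → ≡.trans
          (#-cong (λ z → nonzero? z ×-dec (z ^ n ≟ y)) (λ z → z ^ n ≟ x ^ n)
            (λ z (_ , z^n≈y) → trans z^n≈y (sym x^n≈y))
            (λ z z^n≈x^n → (λ z≈0 → ^-≉0 x≉0 n (trans (sym z^n≈x^n) (trans (^-congˡ n z≈0) (0^n≈0 n))))
                           , trans z^n≈x^n x^n≈y))
          (#power-fibre n x≉0) })
        (λ {x} x≉0 → #-unique (λ y → nonzero? x ×-dec (x ^ n ≟ y))
          (λ y≈z (_ , eq) → x≉0 , trans eq y≈z) (x ^ n) (x≉0 , refl) (λ (_ , eq) → sym eq)))
      (≡.trans (ℕ.*-identityʳ _) #nonzero)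

  ^≈1-∣ : ∀ {x m n} → m ∣ n → x ^ m ≈ 1# → x ^ n ≈ 1#
  ^≈1-∣ {x} {m} (divides k ≡.refl) x^m≈1 = begin
    x ^ (k ℕ.* m) ≈⟨ ^-congʳ x (ℕ.*-comm k m) ⟩
    x ^ (m ℕ.* k) ≈⟨ ^-assocʳ x m k ⟨
    (x ^ m) ^ k   ≈⟨ ^-congˡ k x^m≈1 ⟩
    1# ^ k        ≈⟨ 1^n≈1 k ⟩
    1#            ∎

  ^≈1-difference : ∀ {x d} m {n} → d ℕ.+ m ≡ n → x ^ m ≈ 1# → x ^ n ≈ 1# → x ^ d ≈ 1#
  ^≈1-difference {x} {d} m ≡.refl x^m≈1 x^n≈1 = begin
    x ^ d         ≈⟨ *-identityʳ _ ⟨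
    x ^ d * 1#    ≈⟨ *-congˡ x^m≈1 ⟨
    x ^ d * x ^ m ≈⟨ ^-homo-* x d m ⟨
    x ^ (d ℕ.+ m) ≈⟨ x^n≈1 ⟩
    1#            ∎

  -- Bézout over ℕ yields d + ln = km or d + km = ln. In either case the two larger powers are 1,
  -- and cancelling one of them leaves x^d = 1.
  ^≈1-gcd : ∀ {x} m n → x ^ m ≈ 1# → x ^ n ≈ 1# → x ^ gcd m n ≈ 1#
  ^≈1-gcd {x} m n x^m≈1 x^n≈1 with gcd m n | Bézout.identity (gcd-GCD m n)
  ... | d | Bézout.+- k l d+ln≡km =
    ^≈1-difference (l ℕ.* n) d+ln≡km (^≈1-∣ (divides l ≡.refl) x^n≈1) (^≈1-∣ (divides k ≡.refl) x^m≈1)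
  ... | d | Bézout.-+ k l d+km≡ln =
    ^≈1-difference (k ℕ.* m) d+km≡ln (^≈1-∣ (divides k ≡.refl) x^m≈1) (^≈1-∣ (divides l ≡.refl) x^n≈1)

  -- The first isomorphism theorem in counting form: translation by a preimage of y carries the
  -- kernel onto the fibre over y.
  additive-fibres : ∀ {f} (f-cong : f Preserves _≈_ ⟶ _≈_) → (∀ x y → f (x + y) ≈ f x + f y) →
                    # (image? f-cong) ℕ.* # (λ x → f x ≟ 0#) ≡ Q
  additive-fibres {f} f-cong f-homo = ≡.trans
    (double-count (λ y x → f x ≟ y) (image? f-cong) (λ _ → yes tt) {# (λ x → f x ≟ 0#)} {1}
      (λ {y} {x} p → x , p) _
      (λ { {y} (x , fx≈y) → ≡.trans
        (#-reindex (λ z → f z ≟ y) (λ eq → trans (f-cong (sym eq))) (translation x))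
        (#-cong (λ z → f (z + x) ≟ y) (λ z → f z ≟ 0#)
          (λ z eq → +-cancelʳ y _ _
            (trans (trans (+-congˡ (sym fx≈y)) (sym (f-homo z x))) (trans eq (sym (+-identityˡ y)))))
          (λ z eq → trans (f-homo z x) (trans (+-cong eq fx≈y) (+-identityˡ y)))) })
      (λ {x} _ → #-unique (λ y → f x ≟ y) (λ y≈z eq → trans eq y≈z) (f x) refl sym))
    (≡.trans (ℕ.*-identityʳ _) (sum-1 Q))

  -- Characteristic and Frobenius powers

  card·1≈0 : Q · 1# ≈ 0#
  card·1≈0 = +-cancelˡ ∑all _ 0# (begin
    ∑all + Q · 1#        ≈⟨ +-congˡ (∑-replicate Q) ⟨
    ∑all + ∑ {Q} (λ _ → 1#) ≈⟨ ∑-+ from (λ _ → 1#) ⟨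
    -- Translation by 1 permutes the field and so leaves the sum of all elements unchanged.
    ∑ (λ i → from i + 1#) ≈⟨ sum-reindex +-commutativeMonoid (λ x → x) (λ eq → eq) (translation 1#) ⟨
    ∑all ≈⟨ +-identityʳ _ ⟨
    ∑all + 0# ∎)
    where
    open CommutativeMonoidSum +-commutativeMonoid using ()
      renaming (sum to ∑; ∑-distrib-+ to ∑-+; sum-replicate to ∑-replicate)
    ∑all : Carrier
    ∑all = ∑ from

  p∣n⇒n·x≈0 : ∀ {p n} → p · 1# ≈ 0# → p ∣ n → ∀ x → n · x ≈ 0#
  p∣n⇒n·x≈0 {p} p·1≈0 (divides q ≡.refl) x = begin
    (q ℕ.* p) · x             ≈⟨ ×-congʳ (q ℕ.* p) (*-identityʳ x) ⟨
    (q ℕ.* p) · (x * 1#)      ≈⟨ ×-comm-* (q ℕ.* p) x 1# ⟨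
    x * ((q ℕ.* p) · 1#)      ≈⟨ *-congˡ (×1-homo-* q p) ⟩
    x * ((q · 1#) * (p · 1#)) ≈⟨ *-congˡ (trans (*-congˡ p·1≈0) (zeroʳ _)) ⟩
    x * 0#                    ≈⟨ zeroʳ x ⟩
    0#                        ∎

  -- In the binomial expansion every term but the first and the last has a coefficient divisible by
  -- p.
  freshman : ∀ {p} → Prime p → p · 1# ≈ 0# → ∀ x y → (x + y) ^ p ≈ x ^ p + y ^ p
  freshman {p@(suc p-1)} p-prime p·1≈0 x y = begin
    (x + y) ^ p
      ≈⟨ theorem p x y ⟩
    term Fin.zero + ∑ (λ i → term (Fin.suc i))
      ≈⟨ +-congˡ (sum-init-last (λ i → term (Fin.suc i))) ⟩
    term Fin.zero + (∑ (λ i → term (Fin.suc (Fin.inject₁ i))) + term (Fin.fromℕ p))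
      ≈⟨ +-cong (trans (+-identityʳ _) (*-identityˡ _)) (+-cong middle (last (Fin.toℕ-fromℕ p))) ⟩
    y ^ p + (0# + x ^ p)
      ≈⟨ +-congˡ (+-identityˡ _) ⟩
    y ^ p + x ^ p
      ≈⟨ +-comm _ _ ⟩
    x ^ p + y ^ p ∎
    where
    open BinomialTheorem commutativeSemiring using (theorem; binomialTerm)
    open CommutativeMonoidSum +-commutativeMonoid using (sum-init-last; sum-cong-≋)
      renaming (sum to ∑; sum-replicate-zero to ∑-zero)
    term = binomialTerm x y p
    middle : ∑ (λ i → term (Fin.suc (Fin.inject₁ i))) ≈ 0#
    middle = trans
      (sum-cong-≋ λ i → p∣n⇒n·x≈0 {p} p·1≈0 (prime∣binomial p-prime (s≤s z≤n)
        (s≤s (≡.subst (_< p-1) (≡.sym (Fin.toℕ-inject₁ i)) (Fin.toℕ<n i)))) _)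
      (∑-zero p-1)
    -- Generalised over k, because `Fin.toℕ (Fin.fromℕ p)` equals p only propositionally.
    last : ∀ {k} → k ≡ p → (p C k) · (x ^ k * y ^ (p ∸ k)) ≈ x ^ p
    last ≡.refl = trans (×-congˡ (nCn≡1 p))
      (trans (+-identityʳ _) (trans (*-congˡ (^-congʳ y (ℕ.n∸n≡0 p))) (*-identityʳ _)))

  ^p^-fixed : ∀ {x} p e k → x ^ (p ℕ.^ e) ≈ x → x ^ (p ℕ.^ (k ℕ.* e)) ≈ x
  ^p^-fixed {x} p e zero    fixed = *-identityʳ x
  ^p^-fixed {x} p e (suc k) fixed = begin
    x ^ (p ℕ.^ (e ℕ.+ k ℕ.* e))         ≡⟨ ≡.cong (x ^_) (ℕ.^-distribˡ-+-* p e (k ℕ.* e)) ⟩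
    x ^ (p ℕ.^ e ℕ.* p ℕ.^ (k ℕ.* e))   ≈⟨ ^-assocʳ x (p ℕ.^ e) _ ⟨
    (x ^ (p ℕ.^ e)) ^ (p ℕ.^ (k ℕ.* e)) ≈⟨ ^-congˡ (p ℕ.^ (k ℕ.* e)) fixed ⟩
    x ^ (p ℕ.^ (k ℕ.* e))               ≈⟨ ^p^-fixed p e k fixed ⟩
    x                                   ∎

  ^p^-fixed-difference : ∀ {x} p {d} j {k} → d ℕ.+ j ≡ k →
                         x ^ (p ℕ.^ j) ≈ x → x ^ (p ℕ.^ k) ≈ x → x ^ (p ℕ.^ d) ≈ x
  ^p^-fixed-difference {x} p {d} j ≡.refl fixedʲ fixedᵏ = begin
    x ^ (p ℕ.^ d)               ≈⟨ ^-congˡ (p ℕ.^ d) fixedʲ ⟨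
    (x ^ (p ℕ.^ j)) ^ (p ℕ.^ d) ≈⟨ ^-assocʳ x (p ℕ.^ j) _ ⟩
    x ^ (p ℕ.^ j ℕ.* p ℕ.^ d)
      ≡⟨ ≡.cong (x ^_) (≡.trans (≡.sym (ℕ.^-distribˡ-+-* p j d)) (≡.cong (p ℕ.^_) (ℕ.+-comm j d))) ⟩
    x ^ (p ℕ.^ (d ℕ.+ j))       ≈⟨ fixedᵏ ⟩
    x                           ∎

  -- This is F_(p^e) ∩ F_(p^m) = F_(p^gcd(e,m)), phrased through fixed points of Frobenius powers.
  -- The Bézout argument of `^≈1-gcd` recurs one level up, with exponents of p in place of exponents
  -- of x.
  ^p^-fixed-gcd : ∀ {x} p e m → x ^ (p ℕ.^ e) ≈ x → x ^ (p ℕ.^ m) ≈ x → x ^ (p ℕ.^ gcd e m) ≈ x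
  ^p^-fixed-gcd p e m fixedᵉ fixedᵐ with gcd e m | Bézout.identity (gcd-GCD e m)
  ... | d | Bézout.+- k l d+lm≡ke =
    ^p^-fixed-difference p (l ℕ.* m) d+lm≡ke (^p^-fixed p m l fixedᵐ) (^p^-fixed p e k fixedᵉ)
  ... | d | Bézout.-+ k l d+ke≡lm =
    ^p^-fixed-difference p (k ℕ.* e) d+ke≡lm (^p^-fixed p e k fixedᵉ) (^p^-fixed p m l fixedᵐ)

  module _ {p m} (p-prime : Prime p) (Q≡p^m : Q ≡ p ℕ.^ m) where

    p^k·1≈[p·1]^k : ∀ k → (p ℕ.^ k) · 1# ≈ (p · 1#) ^ k
    p^k·1≈[p·1]^k zero    = +-identityʳ 1#
    p^k·1≈[p·1]^k (suc k) = trans (×1-homo-* p (p ℕ.^ k)) (*-congˡ (p^k·1≈[p·1]^k k))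

    -- The m-th power of p·1 is Q·1 = 0, and a field has no nonzero nilpotents.
    p·1≈0 : p · 1# ≈ 0#
    p·1≈0 with p · 1# ≟ 0#
    ... | yes eq = eq
    ... | no neq = contradiction
      (trans (sym (p^k·1≈[p·1]^k m)) (≡.subst (λ n → n · 1# ≈ 0#) Q≡p^m card·1≈0)) (^-≉0 neq m)

    ^p^-+ : ∀ e x y → (x + y) ^ (p ℕ.^ e) ≈ x ^ (p ℕ.^ e) + y ^ (p ℕ.^ e)
    ^p^-+ zero    x y = trans (*-identityʳ _) (+-cong (sym (*-identityʳ x)) (sym (*-identityʳ y)))
    ^p^-+ (suc e) x y = begin
      (x + y) ^ (p ℕ.* p ℕ.^ e)                   ≈⟨ ^-assocʳ (x + y) p _ ⟨
      ((x + y) ^ p) ^ (p ℕ.^ e)                   ≈⟨ ^-congˡ (p ℕ.^ e) (freshman p-prime p·1≈0 x y) ⟩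
      (x ^ p + y ^ p) ^ (p ℕ.^ e)                 ≈⟨ ^p^-+ e _ _ ⟩
      (x ^ p) ^ (p ℕ.^ e) + (y ^ p) ^ (p ℕ.^ e)   ≈⟨ +-cong (^-assocʳ x p _) (^-assocʳ y p _) ⟩
      x ^ (p ℕ.* p ℕ.^ e) + y ^ (p ℕ.* p ℕ.^ e)   ∎

-- Evaluation of coefficient lists

module Evaluation {c ℓ} (R : CommutativeRing c ℓ) where
  open CommutativeRing R
  open Polynomials R
  open Exp commutativeSemiring
  open RingProperties ring
  open SemiringSolver commutativeSemiring using (solve; _:=_; _:+_; _:*_)
  open import Relation.Binary.Reasoning.Setoid setoid

  eval-cong : ∀ f → eval f Preserves _≈_ ⟶ _≈_
  eval-cong []      x≈y = refl
  eval-cong (a ∷ f) x≈y = +-congˡ (*-cong x≈y (eval-cong f x≈y))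

  eval-+ : ∀ f g x → eval (f +ₚ g) x ≈ eval f x + eval g x
  eval-+ []      g       x = sym (+-identityˡ _)
  eval-+ (a ∷ f) []      x = sym (+-identityʳ _)
  eval-+ (a ∷ f) (b ∷ g) x = trans (+-congˡ (*-congˡ (eval-+ f g x)))
    (solve 5 (λ a b x u v → a :+ b :+ x :* (u :+ v) := a :+ x :* u :+ (b :+ x :* v)) refl a b x (eval f x) (eval g x))

  eval-scale : ∀ a f x → eval (List.map (a *_) f) x ≈ a * eval f x
  eval-scale a []      x = sym (zeroʳ a)
  eval-scale a (b ∷ f) x = trans (+-congˡ (*-congˡ (eval-scale a f x)))
    (solve 4 (λ a b x u → a :* b :+ x :* (a :* u) := a :* (b :+ x :* u)) refl a b x (eval f x))

  eval-neg : ∀ f x → eval (List.map (-_) f) x ≈ - eval f x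
  eval-neg []      x = sym -0#≈0#
  eval-neg (a ∷ f) x = trans (+-congˡ (trans (*-congˡ (eval-neg f x)) (sym (-‿distribʳ-* x _)))) (-‿+-comm a _)

  eval-* : ∀ f g x → eval (f *ₚ g) x ≈ eval f x * eval g x
  eval-* []      g x = sym (zeroˡ _)
  eval-* (a ∷ f) g x = begin
    eval (List.map (a *_) g +ₚ (0# ∷ (f *ₚ g))) x  ≈⟨ eval-+ (List.map (a *_) g) (0# ∷ (f *ₚ g)) x ⟩
    eval (List.map (a *_) g) x + (0# + x * eval (f *ₚ g) x)
      ≈⟨ +-cong (eval-scale a g x) (trans (+-identityˡ _) (*-congˡ (eval-* f g x))) ⟩
    a * eval g x + x * (eval f x * eval g x)
      ≈⟨ solve 4 (λ a x u v → a :* v :+ x :* (u :* v) := (a :+ x :* u) :* v) refl a x (eval f x) (eval g x) ⟩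
    (a + x * eval f x) * eval g x                 ∎

  eval-1 : ∀ x → eval 1ₚ x ≈ 1#
  eval-1 x = trans (+-congˡ (zeroʳ x)) (+-identityʳ 1#)

  eval-U : ∀ x → eval U x ≈ x
  eval-U x = trans (+-identityˡ _) (trans (*-congˡ (eval-1 x)) (*-identityʳ x))

  eval-^ : ∀ f n x → eval (f ^ₚ n) x ≈ eval f x ^ n
  eval-^ f zero    x = eval-1 x
  eval-^ f (suc n) x = trans (eval-* f (f ^ₚ n) x) (*-congˡ (eval-^ f n x))

  eval-Λ : ∀ N h .{{_ : NonZero h}} x → eval (Λ N h) x ≈ x * (x ^ ((N ∸ 1) / h) - 1#) ^ h
  eval-Λ N h x = begin
    eval (Λ N h) x                                     ≈⟨ eval-* U ((U ^ₚ A -ₚ 1ₚ) ^ₚ h) x ⟩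
    eval U x * eval ((U ^ₚ A -ₚ 1ₚ) ^ₚ h) x            ≈⟨ *-cong (eval-U x) (eval-^ (U ^ₚ A -ₚ 1ₚ) h x) ⟩
    x * eval (U ^ₚ A -ₚ 1ₚ) x ^ h
      ≈⟨ *-congˡ (^-congˡ h (eval-+ (U ^ₚ A) (List.map (-_) 1ₚ) x)) ⟩
    x * (eval (U ^ₚ A) x + eval (List.map (-_) 1ₚ) x) ^ h
      ≈⟨ *-congˡ (^-congˡ h (+-cong (trans (eval-^ U A x) (^-congˡ A (eval-U x)))
                                    (trans (eval-neg 1ₚ x) (-‿cong (eval-1 x))))) ⟩
    x * (x ^ A - 1#) ^ h                               ∎
    where A = (N ∸ 1) / h

-- The values missed by Λ

module MissedValues {c ℓ₁ ℓ₂} {p e h m : ℕ} (p-prime : Prime p)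
  .{{_ : NonZero e}} .{{_ : NonZero h}} .{{_ : NonZero m}}
  (h∣N-1 : h ∣ p ℕ.^ e ∸ 1) (F : FiniteField c ℓ₁ ℓ₂ (p ℕ.^ m)) where

  open FiniteField F using (commutativeRing; enumeration; Λ; eval; #image; IsPermutationPolynomial)
  open CommutativeRing commutativeRing
  open FiniteSetoid setoid enumeration
  open FiniteFieldProperties (1<p^k p-prime m) F
  open Evaluation commutativeRing
  open Exp commutativeSemiring
  open RingProperties ring
  open SemiringSolver commutativeSemiring using (solve; _:=_; _:+_; _:*_)
  open import Relation.Binary.Reasoning.Setoid setoid

  private
    N Q s N-1 s-1 A : ℕ
    N   = p ℕ.^ e
    Q   = p ℕ.^ m
    s   = p ℕ.^ gcd e m
    N-1 = N ∸ 1
    s-1 = s ∸ 1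
    A   = N-1 / h

    instance
      N≢0 : NonZero N
      N≢0 = p^k≢0 p-prime e
      s≢0 : NonZero s
      s≢0 = p^k≢0 p-prime (gcd e m)
      Q≢0 : NonZero Q
      Q≢0 = p^k≢0 p-prime m
      N-1≢0 : NonZero N-1
      N-1≢0 = p^k∸1≢0 p-prime e
      s-1≢0 : NonZero s-1
      s-1≢0 = p^k∸1≢0 p-prime (gcd e m) {{gcd≢0 e m}}

  hA≡N-1 : h ℕ.* A ≡ N-1
  hA≡N-1 = m*[n/m]≡n h∣N-1

  instance
    A≢0 : NonZero A
    A≢0 = ℕ.m*n≢0⇒n≢0 h {{≡.subst NonZero (≡.sym hA≡N-1) N-1≢0}}

  s-1∣p^k-1 : ∀ {k} → gcd e m ∣ k → s-1 ∣ p ℕ.^ k ∸ 1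
  s-1∣p^k-1 (divides q ≡.refl) = ≡.subst (λ n → s-1 ∣ n ∸ 1)
    (≡.trans (ℕ.^-*-assoc p (gcd e m) q) (≡.cong (p ℕ.^_) (ℕ.*-comm (gcd e m) q)))
    (geometric-∣ s q)

  s-1∣N-1 : s-1 ∣ N-1
  s-1∣N-1 = s-1∣p^k-1 (gcd[m,n]∣m e m)

  s-1∣Q-1 : s-1 ∣ Q ∸ 1
  s-1∣Q-1 = s-1∣p^k-1 (gcd[m,n]∣n e m)

  ^N≈ : ∀ x → x ^ N ≈ x * x ^ N-1
  ^N≈ x = ^-congʳ x (suc-pred≡ N)

  -- Here gcd(e, m) enters: x^N = x is the hypothesis, x^Q = x is Fermat, and together they give x^s
  -- = x.
  ^N-1≈1⇒^s-1≈1 : ∀ {x} → x ^ N-1 ≈ 1# → x ^ s-1 ≈ 1#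
  ^N-1≈1⇒^s-1≈1 {x} x^N-1≈1 = *-cancelˡ x≉0 (begin
    x * x ^ s-1 ≈⟨ ^-congʳ x (suc-pred≡ s) ⟨
    x ^ s       ≈⟨ ^p^-fixed-gcd p e m (fixed N x^N-1≈1) (fixed Q (fermat x≉0)) ⟩
    x           ≈⟨ *-identityʳ x ⟨
    x * 1#      ∎)
    where
    x≉0 : ¬ x ≈ 0#
    x≉0 = ^≈1⇒≉0 N-1 x^N-1≈1
    fixed : ∀ n .{{_ : NonZero n}} → x ^ (n ∸ 1) ≈ 1# → x ^ n ≈ x
    fixed (suc n) eq = trans (*-congˡ eq) (*-identityʳ x)

  -- N - 1 need not divide Q - 1, but s - 1 does, so after passing to exponent s - 1 the exact count
  -- is available.
  #roots-N-1 : # (root-of-unity? N-1) ≡ s-1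
  #roots-N-1 = ≡.trans
    (#-cong (root-of-unity? N-1) (root-of-unity? s-1) (λ _ → ^N-1≈1⇒^s-1≈1) (λ _ → ^≈1-∣ s-1∣N-1))
    (#roots-of-unity s-1 s-1∣Q-1)

  #roots-A : # (root-of-unity? A) ≡ gcd A s-1
  #roots-A = ≡.trans
    (#-cong (root-of-unity? A) (root-of-unity? (gcd A s-1))
      (λ _ eq → ^≈1-gcd A s-1 eq (^N-1≈1⇒^s-1≈1 (^≈1-∣ (divides h (≡.sym hA≡N-1)) eq)))
      (λ _ → ^≈1-∣ (gcd[m,n]∣m A s-1)))
    (#roots-of-unity (gcd A s-1) {{gcd≢0 A s-1}} (∣-trans (gcd[m,n]∣n A s-1) s-1∣Q-1))

  -- One family for two purposes: γ = 1 gives the map with image V, and γ = a^A the map that must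
  -- reach 1 for a to be a value.
  L : Carrier → Carrier → Carrier
  L γ w = γ * w ^ N - w

  L-cong : ∀ γ → L γ Preserves _≈_ ⟶ _≈_
  L-cong γ x≈y = +-cong (*-congˡ (^-congˡ N x≈y)) (-‿cong x≈y)

  L-+ : ∀ γ x y → L γ (x + y) ≈ L γ x + L γ y
  L-+ γ x y = begin
    γ * (x + y) ^ N - (x + y)
      ≈⟨ +-cong (*-congˡ (^p^-+ {m = m} p-prime ≡.refl e x y)) (sym (-‿+-comm x y)) ⟩
    γ * (x ^ N + y ^ N) + (- x + - y)
      ≈⟨ solve 5 (λ γ a b c d → γ :* (a :+ b) :+ (c :+ d) := γ :* a :+ c :+ (γ :* b :+ d)) refl γ (x ^ N) (y ^ N) (- x) (- y) ⟩
    L γ x + L γ y ∎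

  L1≈ : ∀ y → L 1# y ≈ y * (y ^ N-1 - 1#)
  L1≈ y = begin
    1# * y ^ N - y            ≈⟨ +-congʳ (*-identityˡ _) ⟩
    y ^ N - y                 ≈⟨ +-cong (^N≈ y) (-‿cong (sym (*-identityʳ y))) ⟩
    y * y ^ N-1 - y * 1#      ≈⟨ x[y-z]≈xy-xz y (y ^ N-1) 1# ⟨
    y * (y ^ N-1 - 1#)        ∎

  L1≈0? : ∀ w → Dec (L 1# w ≈ 0#)
  L1≈0? w = L 1# w ≟ 0#

  #kernel : # L1≈0? ≡ s
  #kernel = ≡.trans (≡.sym (#-⊎ (_≟ 0#) (root-of-unity? N-1) L1≈0?
      (λ (w≈0 , w^N-1≈1) → ^≈1⇒≉0 N-1 w^N-1≈1 w≈0)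
      (λ {w} w≈0 → trans (L1≈ w) (trans (*-congʳ w≈0) (zeroˡ _)))
      (λ {w} w^N-1≈1 → trans (L1≈ w) (trans (*-congˡ (x≈y⇒x∙y⁻¹≈ε w^N-1≈1)) (zeroʳ w)))
      (λ {w} → split w)))
    (≡.trans (≡.cong₂ ℕ._+_ (#-≟ 0#) #roots-N-1) (≡.sym (suc-pred≡ s)))
    where
    split : ∀ w → L 1# w ≈ 0# → w ≈ 0# ⊎ w ^ N-1 ≈ 1#
    split w Lw≈0 with w ≟ 0#
    ... | yes w≈0 = inj₁ w≈0
    ... | no w≉0  = inj₂ (x∙y⁻¹≈ε⇒x≈y _ _ (*-cancelˡ w≉0 (trans (sym (L1≈ w)) (trans Lw≈0 (sym (zeroʳ w))))))

  V? : ∀ x → Dec (∃[ y ] L 1# y ≈ x)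
  V? = image? (L-cong 1#)

  V-resp : ∀ {x z} → x ≈ z → (∃[ y ] L 1# y ≈ x) → ∃[ y ] L 1# y ≈ z
  V-resp x≈z (y , Ly≈x) = y , trans Ly≈x x≈z

  #V : # V? ℕ.* s ≡ Q
  #V = ≡.trans (≡.cong (# V? ℕ.*_) (≡.sym #kernel)) (additive-fibres (L-cong 1#) (L-+ 1#))

  -- x witnesses that Λ misses a.
  Witness : Carrier → Carrier → Set (c ⊔ ℓ₁)
  Witness a x = ¬ (∃[ y ] L 1# y ≈ x) × a ^ A ≈ x ^ N-1

  witness? : ∀ a x → Dec (Witness a x)
  witness? a x = ¬? (V? x) ×-dec (a ^ A ≟ x ^ N-1)

  missed? : ∀ a → Dec (∃ (Witness a))
  missed? a = ∃? (witness? a) λ x≈z (x∉V , eq) → (x∉V ∘ V-resp (sym x≈z)) , trans eq (^-congˡ N-1 x≈z)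

  ∉V⇒≉0 : ∀ {x} → ¬ (∃[ y ] L 1# y ≈ x) → ¬ x ≈ 0#
  ∉V⇒≉0 x∉V x≈0 = x∉V (0# , trans (L1≈ 0#) (trans (zeroˡ _) (sym x≈0)))

  -- V is closed under multiplication by ζ with ζ^(N-1) = 1.
  V-resp-^N-1 : ∀ {x z} → ¬ x ≈ 0# → x ^ N-1 ≈ z ^ N-1 → (∃[ y ] L 1# y ≈ x) → ∃[ y ] L 1# y ≈ z
  V-resp-^N-1 {x} {z} x≉0 x^≈z^ (y , Ly≈x) with inverse x≉0
  ... | x⁻¹ , x⁻¹x≈1 = ζ * y , (begin
    L 1# (ζ * y)                  ≈⟨ L1≈ (ζ * y) ⟩
    ζ * y * ((ζ * y) ^ N-1 - 1#)
      ≈⟨ *-congˡ (+-congʳ (trans (^-distrib-* ζ y N-1) (trans (*-congʳ ζ^≈1) (*-identityˡ _)))) ⟩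
    ζ * y * (y ^ N-1 - 1#)        ≈⟨ *-assoc ζ y _ ⟩
    ζ * (y * (y ^ N-1 - 1#))      ≈⟨ *-congˡ (trans (sym (L1≈ y)) Ly≈x) ⟩
    z * x⁻¹ * x                   ≈⟨ trans (*-assoc z x⁻¹ x) (trans (*-congˡ x⁻¹x≈1) (*-identityʳ z)) ⟩
    z                             ∎)
    where
    ζ = z * x⁻¹
    ζ^≈1 : ζ ^ N-1 ≈ 1#
    ζ^≈1 = begin
      (z * x⁻¹) ^ N-1      ≈⟨ ^-distrib-* z x⁻¹ N-1 ⟩
      z ^ N-1 * x⁻¹ ^ N-1  ≈⟨ *-congʳ x^≈z^ ⟨
      x ^ N-1 * x⁻¹ ^ N-1  ≈⟨ ^-distrib-* x x⁻¹ N-1 ⟨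
      (x * x⁻¹) ^ N-1      ≈⟨ ^-congˡ N-1 (trans (*-comm x x⁻¹) x⁻¹x≈1) ⟩
      1# ^ N-1             ≈⟨ 1^n≈1 N-1 ⟩
      1#                   ∎

  -- It shows x^(N-1) to be an A-th power, so each x outside V is a witness for some a, for instance
  -- a = x^h.
  ^h^A≈^N-1 : ∀ x → (x ^ h) ^ A ≈ x ^ N-1
  ^h^A≈^N-1 x = trans (^-assocʳ x h A) (^-congʳ x hA≡N-1)

  -- Pairs (a, x) with x a witness for a. For fixed a the witnesses form one full fibre of the power
  -- N - 1, since `V-resp-^N-1` keeps the whole fibre outside V. For fixed x the a form the fibre of
  -- the power A through x^h.
  #missed*[s-1] : # missed? ℕ.* s-1 ≡ # (¬? ∘ V?) ℕ.* gcd A s-1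
  #missed*[s-1] = double-count witness? missed? (¬? ∘ V?) (λ {a} {x} w → x , w) proj₁
    (λ { {a} (x , x∉V , a^A≈x^N-1) → ≡.trans
      (#-cong (witness? a) (λ z → z ^ N-1 ≟ x ^ N-1)
        (λ z (_ , a^A≈z^N-1) → trans (sym a^A≈z^N-1) a^A≈x^N-1)
        (λ z z^≈x^ → (λ z∈V → x∉V (V-resp-^N-1 (^-≉0⇒≉0 N-1 (^-≉0 (∉V⇒≉0 x∉V) N-1 ∘ trans (sym z^≈x^))) z^≈x^ z∈V))
                     , trans a^A≈x^N-1 (sym z^≈x^)))
      (≡.trans (#power-fibre N-1 (∉V⇒≉0 x∉V)) #roots-N-1) })
    (λ {x} x∉V → ≡.trans
      (#-cong (λ a → witness? a x) (λ a → a ^ A ≟ (x ^ h) ^ A)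
        (λ a (_ , a^A≈x^N-1) → trans a^A≈x^N-1 (sym (^h^A≈^N-1 x)))
        (λ a a^A≈ → x∉V , trans a^A≈ (^h^A≈^N-1 x)))
      (≡.trans (#power-fibre A (^-≉0 (∉V⇒≉0 x∉V) h)) #roots-A))
    where
    ^-≉0⇒≉0 : ∀ {x} n .{{_ : NonZero n}} → ¬ x ^ n ≈ 0# → ¬ x ≈ 0#
    ^-≉0⇒≉0 n x^n≉0 x≈0 = x^n≉0 (trans (^-congˡ n x≈0) (0^n≈0 n))

  -- The complement of V has (s - 1) |V| elements because |V| s = Q, so the factor s - 1 cancels
  -- from the double count.
  #missed*s : # missed? ℕ.* s ≡ gcd A s-1 ℕ.* Q
  #missed*s = ≡.trans (≡.cong (ℕ._* s) #missed≡)
    (≡.trans (ℕ.*-assoc (gcd A s-1) (# V?) s) (≡.cong (gcd A s-1 ℕ.*_) #V))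
    where
    #∉V≡ : # (¬? ∘ V?) ≡ # V? ℕ.* s-1
    #∉V≡ = ℕ.+-cancelˡ-≡ (# V?) _ _ (≡.trans
      (#-partition V? (¬? ∘ V?) (λ v ¬v → ¬v v) (λ {x} → decidable-stable (V? x)))
      (≡.trans (≡.sym #V) (≡.trans (≡.cong (# V? ℕ.*_) (suc-pred≡ s)) (ℕ.*-suc (# V?) s-1))))
    #missed≡ : # missed? ≡ gcd A s-1 ℕ.* # V?
    #missed≡ = ℕ.*-cancelʳ-≡ (# missed?) _ s-1 (≡.trans #missed*[s-1]
      (≡.trans (≡.cong (ℕ._* gcd A s-1) #∉V≡) (rearrange (# V?) s-1 (gcd A s-1))))
      where
      rearrange : ∀ v t g → v ℕ.* t ℕ.* g ≡ g ℕ.* v ℕ.* t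
      rearrange = ℕ-Solver.solve-∀

  missed⇒not-value : ∀ {a} → ∃ (Witness a) → ∀ u → ¬ u * (u ^ A - 1#) ^ h ≈ a
  missed⇒not-value {a} (x , x∉V , a^A≈x^N-1) u ut^h≈a = x∉V (y , (begin
    L 1# y             ≈⟨ L1≈ y ⟩
    y * (y ^ N-1 - 1#) ≈⟨ *-congˡ (+-congʳ y^N-1≈u^A) ⟩
    y * t              ≈⟨ *-comm y t ⟩
    t * y              ≈⟨ ty≈x ⟩
    x                  ∎))
    where
    t = u ^ A - 1#
    a≉0 : ¬ a ≈ 0#
    a≉0 a≈0 = ^-≉0 (∉V⇒≉0 x∉V) N-1 (trans (sym a^A≈x^N-1) (trans (^-congˡ A a≈0) (0^n≈0 A)))
    t≉0 : ¬ t ≈ 0#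
    t≉0 t≈0 = a≉0 (trans (sym ut^h≈a) (trans (*-congˡ (trans (^-congˡ h t≈0) (0^n≈0 h))) (zeroʳ u)))
    t⁻¹ = proj₁ (inverse t≉0)
    y = t⁻¹ * x
    ty≈x : t * y ≈ x
    ty≈x = inverse-cancels (trans (*-comm t t⁻¹) (proj₂ (inverse t≉0))) x
    -- Both t^(N-1) y^(N-1) and u^A (t^h)^A equal a^A, and (t^h)^A = t^(N-1) cancels.
    y^N-1≈u^A : y ^ N-1 ≈ u ^ A
    y^N-1≈u^A = *-cancelˡ (^-≉0 t≉0 N-1) (begin
      t ^ N-1 * y ^ N-1   ≈⟨ ^-distrib-* t y N-1 ⟨
      (t * y) ^ N-1       ≈⟨ ^-congˡ N-1 ty≈x ⟩
      x ^ N-1             ≈⟨ a^A≈x^N-1 ⟨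
      a ^ A               ≈⟨ ^-congˡ A ut^h≈a ⟨
      (u * t ^ h) ^ A     ≈⟨ ^-distrib-* u (t ^ h) A ⟩
      u ^ A * (t ^ h) ^ A ≈⟨ *-congˡ (^h^A≈^N-1 t) ⟩
      u ^ A * t ^ N-1     ≈⟨ *-comm _ _ ⟩
      t ^ N-1 * u ^ A     ∎)

  L≈1⇒value : ∀ {a w} → L (a ^ A) w ≈ 1# → a * w ^ h * ((a * w ^ h) ^ A - 1#) ^ h ≈ a
  L≈1⇒value {a} {w} Lw≈1 = begin
    a * w ^ h * ((a * w ^ h) ^ A - 1#) ^ h          ≈⟨ *-assoc a _ _ ⟩
    a * (w ^ h * ((a * w ^ h) ^ A - 1#) ^ h)        ≈⟨ *-congˡ (^-distrib-* w _ h) ⟨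
    a * (w * ((a * w ^ h) ^ A - 1#)) ^ h            ≈⟨ *-congˡ (^-congˡ h inner≈1) ⟩
    a * 1# ^ h                                      ≈⟨ *-congˡ (1^n≈1 h) ⟩
    a * 1#                                          ≈⟨ *-identityʳ a ⟩
    a                                               ∎
    where
    inner≈1 : w * ((a * w ^ h) ^ A - 1#) ≈ 1#
    inner≈1 = begin
      w * ((a * w ^ h) ^ A - 1#)         ≈⟨ x[y-z]≈xy-xz w _ 1# ⟩
      w * (a * w ^ h) ^ A - w * 1#
        ≈⟨ +-cong (*-congˡ (trans (^-distrib-* a (w ^ h) A) (*-congˡ (^h^A≈^N-1 w)))) (-‿cong (*-identityʳ w)) ⟩
      w * (a ^ A * w ^ N-1) - w
        ≈⟨ +-congʳ (solve 3 (λ w a b → w :* (a :* b) := a :* (w :* b)) refl w (a ^ A) (w ^ N-1)) ⟩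
      a ^ A * (w * w ^ N-1) - w          ≈⟨ +-congʳ (*-congˡ (^N≈ w)) ⟨
      L (a ^ A) w                        ≈⟨ Lw≈1 ⟩
      1#                                 ∎

  not-missed⇒L≈1 : ∀ {a} → ¬ a ≈ 0# → ¬ ∃ (Witness a) → ∃[ w ] L (a ^ A) w ≈ 1#
  not-missed⇒L≈1 {a} a≉0 ¬missed
    with ∃? (λ w → nonzero? w ×-dec (L (a ^ A) w ≟ 0#))
            (λ w≈z (w≉0 , Lw≈0) → (w≉0 ∘ trans w≈z) , trans (L-cong (a ^ A) (sym w≈z)) Lw≈0)
  -- A trivial kernel makes the image have Q elements, so 1 lies in it.
  ... | no trivial-kernel = #-full (image? (L-cong γ)) (λ y≈z (w , Lw≈y) → w , trans Lw≈y y≈z) #image≡Q 1#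
    where
    γ = a ^ A
    #image≡Q : # (image? (L-cong γ)) ≡ Q
    #image≡Q = ≡.trans (≡.sym (ℕ.*-identityʳ _)) (≡.trans (≡.cong (# (image? (L-cong γ)) ℕ.*_) (≡.sym #kernel≡1))
                 (additive-fibres (L-cong γ) (L-+ γ)))
      where
      L0≈0 : L γ 0# ≈ 0#
      L0≈0 = trans (+-cong (trans (*-congˡ (0^n≈0 N)) (zeroʳ γ)) -0#≈0#) (+-identityˡ 0#)
      #kernel≡1 : # (λ w → L γ w ≟ 0#) ≡ 1
      #kernel≡1 = #-unique (λ w → L γ w ≟ 0#) (λ w≈z → trans (L-cong γ (sym w≈z))) 0# L0≈0
        (λ {w} Lw≈0 → zero-of w Lw≈0)
        where
        zero-of : ∀ w → L γ w ≈ 0# → w ≈ 0#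
        zero-of w Lw≈0 with w ≟ 0#
        ... | yes w≈0 = w≈0
        ... | no w≉0  = contradiction (w , w≉0 , Lw≈0) trivial-kernel
  ... | yes (w , w≉0 , Lw≈0) with inverse w≉0
  ...   | x , xw≈1 with V? x
  ...     | no x∉V        = contradiction (x , x∉V , a^A≈x^N-1) ¬missed
    where
    γw^N≈w : a ^ A * w ^ N ≈ w
    γw^N≈w = x∙y⁻¹≈ε⇒x≈y _ _ Lw≈0
    a^A≈x^N-1 : a ^ A ≈ x ^ N-1
    a^A≈x^N-1 = *-cancelˡ (^-≉0 w≉0 N-1) (begin
      w ^ N-1 * a ^ A    ≈⟨ *-cancelˡ w≉0 (begin
        w * (w ^ N-1 * a ^ A)
          ≈⟨ solve 3 (λ w b a → w :* (b :* a) := a :* (w :* b)) refl w (w ^ N-1) (a ^ A) ⟩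
        a ^ A * (w * w ^ N-1) ≈⟨ *-congˡ (^N≈ w) ⟨
        a ^ A * w ^ N         ≈⟨ γw^N≈w ⟩
        w                     ≈⟨ *-identityʳ w ⟨
        w * 1#                ∎) ⟩
      1#                 ≈⟨ 1^n≈1 N-1 ⟨
      1# ^ N-1           ≈⟨ ^-congˡ N-1 (trans (*-comm w x) xw≈1) ⟨
      (w * x) ^ N-1      ≈⟨ ^-distrib-* w x N-1 ⟩
      w ^ N-1 * x ^ N-1  ∎)
  -- From a^A w^N = w the map at w y becomes w (y^N - y) = w x = 1.
  ...     | yes (y , Ly≈x) = w * y , (begin
    a ^ A * (w * y) ^ N - w * y    ≈⟨ +-congʳ (*-congˡ (^-distrib-* w y N)) ⟩
    a ^ A * (w ^ N * y ^ N) - w * y ≈⟨ +-congʳ (*-assoc _ _ _) ⟨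
    a ^ A * w ^ N * y ^ N - w * y  ≈⟨ +-congʳ (*-congʳ (x∙y⁻¹≈ε⇒x≈y _ _ Lw≈0)) ⟩
    w * y ^ N - w * y              ≈⟨ x[y-z]≈xy-xz w _ y ⟨
    w * (y ^ N - y)                ≈⟨ *-congˡ (+-congʳ (*-identityˡ _)) ⟨
    w * L 1# y                     ≈⟨ *-congˡ Ly≈x ⟩
    w * x                          ≈⟨ trans (*-comm w x) xw≈1 ⟩
    1#                             ∎)

  not-missed⇒value : ∀ {a} → ¬ ∃ (Witness a) → ∃[ u ] u * (u ^ A - 1#) ^ h ≈ a
  not-missed⇒value {a} ¬missed with a ≟ 0#
  ... | yes a≈0 = 0# , trans (zeroˡ _) (sym a≈0)
  ... | no a≉0  = let w , Lw≈1 = not-missed⇒L≈1 a≉0 ¬missed in a * w ^ h , L≈1⇒value Lw≈1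

  #image+#missed≡Q : #image (Λ N h) ℕ.+ # missed? ≡ Q
  #image+#missed≡Q = ≡.trans
    (≡.cong (ℕ._+ # missed?) (#-image (eval-cong (Λ N h))))
    (#-partition (image? (eval-cong (Λ N h))) missed?
      (λ (u , Λu≈a) missed → missed⇒not-value missed u (trans (sym (eval-Λ N h u)) Λu≈a))
      (λ ¬missed → let u , eq = not-missed⇒value ¬missed in u , trans (eval-Λ N h u) eq))

  -- Surjectivity fails: gcd(A, s - 1) Q is positive, hence so is the number of missed values.
  not-permutation : ¬ IsPermutationPolynomial (Λ N h)
  not-permutation (_ , surjective) = ℕ.≢-nonZero⁻¹ (gcd A s-1 ℕ.* Q) {{ℕ.m*n≢0 (gcd A s-1) Q {{gcd≢0 A s-1}}}}
    (≡.trans (≡.sym #missed*s) (≡.cong (ℕ._* s) (#-empty missed? λ a missed →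
      let u , Λ≈a = surjective a in missed⇒not-value missed u (trans (sym (eval-Λ N h u)) (Λ≈a refl)))))

-- Rational arithmetic

/-≡ : ∀ i j m n .{{_ : NonZero m}} .{{_ : NonZero n}} →
      i ℤ.* + n ≡ j ℤ.* + m → i ℚ./ m ≡ j ℚ./ n
/-≡ i j (suc m) (suc n) eq = ℚ.fromℚᵘ-cong {mkℚᵘ i m} {mkℚᵘ j n} (*≡* eq)

/1-homo-- : ∀ i j → (i ℤ.- j) ℚ./ 1 ≡ (i ℚ./ 1) ℚ.- (j ℚ./ 1)
/1-homo-- i j = ℚ.toℚᵘ-injective (begin
  ℚ.toℚᵘ ((i ℤ.- j) ℚ./ 1)               ≈⟨ ℚ.toℚᵘ-fromℚᵘ (mkℚᵘ (i ℤ.- j) 0) ⟩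
  mkℚᵘ (i ℤ.- j) 0                       ≈⟨ *≡* (unfold i j) ⟩
  mkℚᵘ i 0 ℚᵘ.- mkℚᵘ j 0
    ≈⟨ ℚᵘ.+-cong (ℚ.toℚᵘ-fromℚᵘ (mkℚᵘ i 0)) (ℚᵘ.-‿cong (ℚ.toℚᵘ-fromℚᵘ (mkℚᵘ j 0))) ⟨
  ℚ.toℚᵘ (i ℚ./ 1) ℚᵘ.- ℚ.toℚᵘ (j ℚ./ 1) ≈⟨ ℚᵘ.+-congʳ (ℚ.toℚᵘ (i ℚ./ 1)) (ℚ.toℚᵘ-homo‿- (j ℚ./ 1)) ⟨
  ℚ.toℚᵘ (i ℚ./ 1) ℚᵘ.+ ℚ.toℚᵘ (ℚ.- (j ℚ./ 1)) ≈⟨ ℚ.toℚᵘ-homo-+ (i ℚ./ 1) (ℚ.- (j ℚ./ 1)) ⟨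
  ℚ.toℚᵘ ((i ℚ./ 1) ℚ.- (j ℚ./ 1))       ∎)
  where
  open ℚᵘ.≃-Reasoning
  unfold : ∀ i j → (i ℤ.+ ℤ.- j) ℤ.* (+ 1) ≡ (i ℤ.* + 1 ℤ.+ (ℤ.- j) ℤ.* + 1) ℤ.* + 1
  unfold = ℤ-Solver.solve-∀

floor-unique : ∀ p z → z ℤ.* ↧ p ℤ.≤ ↥ p → ↥ p ℤ.< ℤ.suc z ℤ.* ↧ p → floor p ≡ z
floor-unique p@record{} z lower upper = ℤ.≤-antisym
  (<suc⇒≤ (ℤ.*-cancelʳ-<-nonNeg (↧ p) (ℤ.≤-<-trans (ℤ.[n/d]*d≤n (↥ p) (↧ p)) upper)))
  (<suc⇒≤ (ℤ.*-cancelʳ-<-nonNeg (↧ p) (ℤ.≤-<-trans lower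
    (≡.subst (λ q → ↥ p ℤ.< ℤ.suc q ℤ.* ↧ p) (≡.sym (ℤ.div-pos-is-/ℕ (↥ p) (ℚ.↧ₙ p)))
      (ℤ.n<s[n/ℕd]*d (↥ p) (ℚ.↧ₙ p))))))
  where
  <suc⇒≤ : ∀ {i j} → i ℤ.< ℤ.suc j → i ℤ.≤ j
  <suc⇒≤ {i} {j} i<1+j = ≡.subst (i ℤ.≤_) (ℤ.pred-suc j) (ℤ.i<j⇒i≤pred[j] i<1+j)

-- The ceiling of p is minus the floor of -p, so negating both bounds reduces the claim to
-- `floor-unique`.
ceiling-unique : ∀ p z → ↥ p ℤ.≤ z ℤ.* ↧ p → (z ℤ.- + 1) ℤ.* ↧ p ℤ.< ↥ p → ceiling p ≡ z
ceiling-unique p@record{} z upper lower = ≡.trans (≡.cong ℤ.-_ (floor-unique (ℚ.- p) (ℤ.- z)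
    (≡.subst₂ ℤ._≤_ (≡.trans (ℤ.neg-distribˡ-* z (↧ p)) (≡.cong (ℤ.- z ℤ.*_) (≡.sym (ℚ.↧-neg p))))
                    (≡.sym (ℚ.↥-neg p)) (ℤ.neg-mono-≤ upper))
    (≡.subst₂ ℤ._<_ (≡.sym (ℚ.↥-neg p))
                    (≡.trans (flip z (↧ p)) (≡.cong (ℤ.suc (ℤ.- z) ℤ.*_) (≡.sym (ℚ.↧-neg p))))
                    (ℤ.neg-mono-< lower))))
  (ℤ.neg-involutive z)
  where
  flip : ∀ z d → ℤ.- ((z ℤ.- + 1) ℤ.* d) ≡ (+ 1 ℤ.+ ℤ.- z) ℤ.* d
  flip = ℤ-Solver.solve-∀

-- The rational is stored in lowest terms, so the bounds on i and n are carried over to its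
-- numerator and denominator by cross-multiplication.
ceiling-/ : ∀ i n .{{_ : NonZero n}} z → i ℤ.≤ z ℤ.* + n → (z ℤ.- + 1) ℤ.* + n ℤ.< i → ceiling (i ℚ./ n) ≡ z
ceiling-/ i n@(suc n-1) z upper lower with i ℚ./ n | ℚ.toℚᵘ-fromℚᵘ (mkℚᵘ i n-1)
... | p@record{} | *≡* ↥p*n≡i*↧p = ceiling-unique p z
  (ℤ.*-cancelʳ-≤-pos (↥ p) (z ℤ.* ↧ p) (+ n)
    (≡.subst₂ ℤ._≤_ (≡.sym ↥p*n≡i*↧p) (swap z (+ n) (↧ p)) (ℤ.*-monoʳ-≤-nonNeg (↧ p) upper)))
  (ℤ.*-cancelʳ-<-nonNeg (+ n)
    (≡.subst₂ ℤ._<_ (swap (z ℤ.- + 1) (+ n) (↧ p)) (≡.sym ↥p*n≡i*↧p) (ℤ.*-monoʳ-<-pos (↧ p) lower)))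
  where
  swap : ∀ a b c → a ℤ.* b ℤ.* c ≡ a ℤ.* c ℤ.* b
  swap = ℤ-Solver.solve-∀

-- The fraction is k - 1/n, which exceeds k - 1 exactly because n > 1.
ceiling-[kn-1]/n : ∀ k n .{{_ : NonZero n}} .{{_ : NonZero k}} → 1 < n → ceiling (+ (k ℕ.* n ∸ 1) ℚ./ n) ≡ + k
ceiling-[kn-1]/n (suc k) n@(suc n-1) (s≤s 0<n-1) = ceiling-/ (+ (n-1 ℕ.+ k ℕ.* n)) n (+ suc k)
  (≡.subst (+ (n-1 ℕ.+ k ℕ.* n) ℤ.≤_) (ℤ.pos-* (suc k) n) (ℤ.+≤+ (ℕ.n≤1+n _)))
  (≡.subst (ℤ._< + (n-1 ℕ.+ k ℕ.* n)) (ℤ.pos-* k n)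
    (ℤ.+<+ (ℕ.+-monoˡ-< (k ℕ.* n) 0<n-1)))

-- Multiplying by t gives gcd(th, hA) = h gcd(t, A). With t = s - 1 and hA = N - 1 this converts κ
-- into the gcd(A, s - 1) of the count.
gcd-quotient : ∀ h A t .{{_ : NonZero t}} → t ∣ h ℕ.* A → gcd h ((h ℕ.* A) / t) ℕ.* t ≡ h ℕ.* gcd A t
gcd-quotient h A t t∣hA = begin
  gcd h C ℕ.* t               ≡⟨ ℕ.*-comm (gcd h C) t ⟩
  t ℕ.* gcd h C               ≡⟨ c*gcd[m,n]≡gcd[cm,cn] t h C ⟩
  gcd (t ℕ.* h) (t ℕ.* C)     ≡⟨ ≡.cong₂ gcd (ℕ.*-comm t h) (≡.trans (ℕ.*-comm t C) (m/n*n≡m t∣hA)) ⟩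
  gcd (h ℕ.* t) (h ℕ.* A)     ≡⟨ c*gcd[m,n]≡gcd[cm,cn] h t A ⟨
  h ℕ.* gcd t A               ≡⟨ ≡.cong (h ℕ.*_) (gcd-comm t A) ⟩
  h ℕ.* gcd A t               ∎
  where
  open ≡.≡-Reasoning
  C = (h ℕ.* A) / t

∣⇒gcd≡ : ∀ {m n} → m ∣ n → gcd m n ≡ m
∣⇒gcd≡ {m} {n} m∣n = ∣-antisym (gcd[m,n]∣m m n) (gcd-greatest ∣-refl m∣n)

bound-minus : ∀ {Q v μ} c → v ℕ.+ μ ≡ Q → + Q ℤ.- c ℤ.- + v ≡ + μ ℤ.- c
bound-minus {v = v} {μ} c ≡.refl = cancel (+ v) (+ μ) c
  where
  cancel : ∀ v μ c → v ℤ.+ μ ℤ.- c ℤ.- v ≡ μ ℤ.- c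
  cancel = ℤ-Solver.solve-∀

-- The defect formula, the subfield case and equality in the bound

open import Data.Nat.Base using (_*_; _^_)
open import Data.Nat.Properties using (m*n≢0)

theorem5p5 :
  ∀ {c ℓ₁ ℓ₂ : Level} (p e h m : ℕ) (p-prime : Prime p)
    .{{_ : NonZero e}} .{{_ : NonZero h}} .{{_ : NonZero m}} →
  let N = p ^ e
      Q = p ^ m
      d = gcd e m
      s = p ^ d
      instance
        N≢0 : NonZero N
        N≢0 = p^k≢0 p-prime e
        s≢0 : NonZero s
        s≢0 = p^k≢0 p-prime d
        s∸1≢0 : NonZero (s ∸ 1)
        s∸1≢0 = p^k∸1≢0 p-prime d {{gcd≢0 e m}}
        hs≢0 : NonZero (h * s)
        hs≢0 = m*n≢0 h s
        Nh≢0 : NonZero (N * h)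
        Nh≢0 = m*n≢0 N h
      C = (N ∸ 1) / (s ∸ 1)
      κ = gcd h C
      ⌈[Q-1]/N⌉ = ceiling (+ (Q ∸ 1) ℚ./ N)
  in
  h ∣ N ∸ 1 →
  N ≤ Q →
  (F : FiniteField c ℓ₁ ℓ₂ Q) →
  let open FiniteField F
      #Λ = #image (Λ N h)
      defect = wanShiueChenBound Q N ℤ.- + #Λ
  in
  ¬ IsPermutationPolynomial (Λ N h)
  × defect ℚ./ 1 ≡ (+ (κ * (s ∸ 1) * Q) ℚ./ (h * s)) ℚ.- (⌈[Q-1]/N⌉ ℚ./ 1)
  -- Inside a fixed algebraic closure, 𝔽_N ⊆ 𝔽_Q means e ∣ m.
  × (e ∣ m → defect ℚ./ 1 ≡ + (Q * (N ∸ 1 ∸ h)) ℚ./ (N * h))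
  × (e ∣ m → (+ #Λ ≡ wanShiueChenBound Q N ⇔ h ≡ N ∸ 1))

theorem5p5 p e h m p-prime {{e≢0}} {{h≢0}} {{m≢0}} h∣N-1 N≤Q F =
  not-permutation , defect-formula , subfield-defect , λ e∣m → mk⇔ (attained⇒ e∣m) (⇒attained e∣m)
  where
  open FiniteField F using (#image; Λ; setoid; enumeration)
  open FiniteSetoid setoid enumeration using (#)
  open MissedValues {e = e} {h} {m} p-prime h∣N-1 F
  open ≡.≡-Reasoning

  N Q s A k μ v : ℕ
  N = p ^ e
  Q = p ^ m
  s = p ^ gcd e m
  A = (N ∸ 1) / h
  -- When e divides m, this is Q / N, and also the ceiling of (Q - 1) / N.
  k = p ^ (m ∸ e)
  μ = # missed?
  v = #image (Λ N h)

  instance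
    N≢0 : NonZero N
    N≢0 = p^k≢0 p-prime e
    s-1≢0 : NonZero (s ∸ 1)
    s-1≢0 = p^k∸1≢0 p-prime (gcd e m) {{gcd≢0 e m}}
    hs≢0 : NonZero (h * s)
    hs≢0 = m*n≢0 h s {{h≢0}} {{p^k≢0 p-prime (gcd e m)}}
    Nh≢0 : NonZero (N * h)
    Nh≢0 = m*n≢0 N h
    k≢0 : NonZero k
    k≢0 = p^k≢0 p-prime (m ∸ e)

  κ : ℕ
  κ = gcd h ((N ∸ 1) / (s ∸ 1))

  defect : ℤ
  defect = wanShiueChenBound Q N ℤ.- + v

  ⌈[Q-1]/N⌉ : ℤ
  ⌈[Q-1]/N⌉ = ceiling (+ (Q ∸ 1) ℚ./ N)

  defect≡ : defect ≡ + μ ℤ.- ⌈[Q-1]/N⌉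
  defect≡ = bound-minus ⌈[Q-1]/N⌉ #image+#missed≡Q

  κ[s-1]≡hD : κ * (s ∸ 1) ≡ h * gcd A (s ∸ 1)
  κ[s-1]≡hD = ≡.subst (λ n → s ∸ 1 ∣ n → gcd h (n / (s ∸ 1)) * (s ∸ 1) ≡ h * gcd A (s ∸ 1))
    hA≡N-1 (gcd-quotient h A (s ∸ 1)) s-1∣N-1

  μhs≡ : μ * (h * s) ≡ κ * (s ∸ 1) * Q
  μhs≡ = begin
    μ * (h * s)               ≡⟨ rearrange μ h s ⟩
    h * (μ * s)               ≡⟨ ≡.cong (h *_) #missed*s ⟩
    h * (gcd A (s ∸ 1) * Q)   ≡⟨ ℕ.*-assoc h _ Q ⟨
    h * gcd A (s ∸ 1) * Q     ≡⟨ ≡.cong (_* Q) κ[s-1]≡hD ⟨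
    κ * (s ∸ 1) * Q           ∎
    where
    rearrange : ∀ μ h s → μ * (h * s) ≡ h * (μ * s)
    rearrange = ℕ-Solver.solve-∀

  defect-formula : defect ℚ./ 1 ≡ (+ (κ * (s ∸ 1) * Q) ℚ./ (h * s)) ℚ.- (⌈[Q-1]/N⌉ ℚ./ 1)
  defect-formula = begin
    defect ℚ./ 1                             ≡⟨ ≡.cong (ℚ._/ 1) defect≡ ⟩
    (+ μ ℤ.- ⌈[Q-1]/N⌉) ℚ./ 1                ≡⟨ /1-homo-- (+ μ) ⌈[Q-1]/N⌉ ⟩
    (+ μ ℚ./ 1) ℚ.- (⌈[Q-1]/N⌉ ℚ./ 1)
      ≡⟨ ≡.cong (ℚ._- (⌈[Q-1]/N⌉ ℚ./ 1)) (/-≡ (+ μ) (+ (κ * (s ∸ 1) * Q)) 1 (h * s) μhs≡ℤ) ⟩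
    (+ (κ * (s ∸ 1) * Q) ℚ./ (h * s)) ℚ.- (⌈[Q-1]/N⌉ ℚ./ 1) ∎
    where
    μhs≡ℤ : + μ ℤ.* + (h * s) ≡ + (κ * (s ∸ 1) * Q) ℤ.* + 1
    μhs≡ℤ = ≡.trans (≡.sym (ℤ.pos-* μ (h * s))) (≡.trans (≡.cong +_ μhs≡) (≡.sym (ℤ.*-identityʳ _)))

  A≡1+[A-1] : A ≡ suc (A ∸ 1)
  A≡1+[A-1] = suc-pred≡ A

  N-1-h≡h[A-1] : N ∸ 1 ∸ h ≡ h * (A ∸ 1)
  N-1-h≡h[A-1] = ≡.trans (≡.cong₂ _∸_ (≡.sym hA≡N-1) (≡.sym (ℕ.*-identityʳ h))) (≡.sym (ℕ.*-distribˡ-∸ h A 1))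

  module _ (e∣m : e ∣ m) where
    Q≡kN : Q ≡ k * N
    Q≡kN = ≡.trans (≡.cong (p ^_) (≡.sym (ℕ.m∸n+n≡m (∣⇒≤ e∣m)))) (ℕ.^-distribˡ-+-* p (m ∸ e) e)

    -- Now gcd(e, m) = e, so s = N, and gcd(A, N - 1) = A because A divides N - 1.
    μ≡Ak : μ ≡ A * k
    μ≡Ak = ℕ.*-cancelʳ-≡ μ (A * k) N (begin
      μ * N                        ≡⟨ ≡.cong (λ d → μ * p ^ d) (∣⇒gcd≡ e∣m) ⟨
      μ * s                        ≡⟨ #missed*s ⟩
      gcd A (s ∸ 1) * Q            ≡⟨ ≡.cong (λ d → gcd A (p ^ d ∸ 1) * Q) (∣⇒gcd≡ e∣m) ⟩
      gcd A (N ∸ 1) * Q            ≡⟨ ≡.cong₂ _*_ (∣⇒gcd≡ (divides h (≡.sym hA≡N-1))) Q≡kN ⟩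
      A * (k * N)                  ≡⟨ ℕ.*-assoc A k N ⟨
      A * k * N                    ∎)

    -- The ceiling removes exactly one k from μ = A k. As k > 0, the defect vanishes exactly when A
    -- = 1, that is, when h = N - 1.
    defect≡[A-1]k : defect ≡ + ((A ∸ 1) * k)
    defect≡[A-1]k = begin
      defect                               ≡⟨ defect≡ ⟩
      + μ ℤ.- ⌈[Q-1]/N⌉
        ≡⟨ ≡.cong₂ (λ x n → + x ℤ.- ceiling (+ (n ∸ 1) ℚ./ N)) μ≡k+[A-1]k Q≡kN ⟩
      + (k ℕ.+ (A ∸ 1) * k) ℤ.- ceiling (+ (k * N ∸ 1) ℚ./ N)
        ≡⟨ ≡.cong (λ z → + (k ℕ.+ (A ∸ 1) * k) ℤ.- z) (ceiling-[kn-1]/n k N (1<p^k p-prime e)) ⟩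
      + k ℤ.+ + ((A ∸ 1) * k) ℤ.- + k      ≡⟨ cancel (+ k) (+ ((A ∸ 1) * k)) ⟩
      + ((A ∸ 1) * k)                      ∎
      where
      μ≡k+[A-1]k : μ ≡ k ℕ.+ (A ∸ 1) * k
      μ≡k+[A-1]k = ≡.trans μ≡Ak (≡.cong (_* k) A≡1+[A-1])
      cancel : ∀ x y → x ℤ.+ y ℤ.- x ≡ y
      cancel = ℤ-Solver.solve-∀

    subfield-defect : defect ℚ./ 1 ≡ + (Q * (N ∸ 1 ∸ h)) ℚ./ (N * h)
    subfield-defect = ≡.trans (≡.cong (ℚ._/ 1) defect≡[A-1]k)
      (/-≡ (+ ((A ∸ 1) * k)) (+ (Q * (N ∸ 1 ∸ h))) 1 (N * h)
        (≡.trans (≡.sym (ℤ.pos-* ((A ∸ 1) * k) (N * h))) (≡.trans (≡.cong +_ (begin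
          (A ∸ 1) * k * (N * h)     ≡⟨ rearrange (A ∸ 1) k N h ⟩
          k * N * (h * (A ∸ 1))     ≡⟨ ≡.cong₂ _*_ Q≡kN N-1-h≡h[A-1] ⟨
          Q * (N ∸ 1 ∸ h)           ∎)) (≡.sym (ℤ.*-identityʳ _)))))
      where
      rearrange : ∀ a k n h → a * k * (n * h) ≡ k * n * (h * a)
      rearrange = ℕ-Solver.solve-∀

    attained⇒ : + v ≡ wanShiueChenBound Q N → h ≡ N ∸ 1
    attained⇒ v≡bound = begin
      h              ≡⟨ ℕ.*-identityʳ h ⟨
      h * 1          ≡⟨ ≡.cong (λ a → h * suc a) A-1≡0 ⟨
      h * suc (A ∸ 1) ≡⟨ ≡.cong (h *_) A≡1+[A-1] ⟨
      h * A          ≡⟨ hA≡N-1 ⟩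
      N ∸ 1          ∎
      where
      A-1≡0 : A ∸ 1 ≡ 0
      A-1≡0 = ℕ.m*n≡0⇒m≡0 (A ∸ 1) k (ℤ.+-injective (≡.trans (≡.sym defect≡[A-1]k)
        (≡.trans (≡.cong (ℤ._- + v) (≡.sym v≡bound)) (ℤ.+-inverseʳ (+ v)))))

    ⇒attained : h ≡ N ∸ 1 → + v ≡ wanShiueChenBound Q N
    ⇒attained h≡N-1 = ≡.sym (ℤ.i-j≡0⇒i≡j (wanShiueChenBound Q N) (+ v)
      (≡.trans defect≡[A-1]k (≡.cong (λ a → + (a * k)) A-1≡0)))
      where
      A-1≡0 : A ∸ 1 ≡ 0
      A-1≡0 = ℕ.m*n≡0⇒m≡0 (A ∸ 1) h (≡.trans (ℕ.*-comm (A ∸ 1) h)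
        (≡.trans (≡.sym N-1-h≡h[A-1]) (ℕ.m≤n⇒m∸n≡0 (ℕ.≤-reflexive (≡.sym h≡N-1)))))
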